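{- Let $m$ and $\ell$ be positive integers, let $d=\gcd(m,\ell)$, and let $n$ be an integer with $2\le n\le m$. Then $H(n;\ell,m)=1$ if and only if $H(n;m/d)\le d$. That is: there exist pairwise distinct $x_1,\dots,x_n\in\Omega_m$ with $x_1^{\ell}+\cdots+x_n^{\ell}=0$ if and only if $n\in W(m/d)$ and there exist $y_1,\dots,y_n\in\Omega_{m/d}$ with $y_1+\cdots+y_n=0$ in which each element of $\Omega_{m/d}$ occurs at most $d$ times among $y_1,\dots,y_n$.
   Context: For a positive integer $k$, $\Omega_k$ denotes the set of complex $k$th roots of unity. For positive integers $m,\ell$, $W_\ell(m)$ is the set of positive integers $n$ for which there exist $x_1,\dots,x_n\in\Omega_m$ (repetition allowed) with $x_1^{\ell}+\cdots+x_n^{\ell}=0$; $W(m)=W_1(m)$. For $n\in W_\ell(m)$, the height $H(n;\ell,m)$ is the smallest positive integer $h$ such that there exist $x_1,\dots,x_n\in\Omega_m$ with $x_1^{\ell}+\cdots+x_n^{\ell}=0$ and every value occurs at most $h$ times in the list $x_1,\dots,x_n$ (the maximum multiplicity is $h$). For $n\in W(m)$, $H(n;m)$ denotes $H(n;1,m)$. The statement $H(n;\ell,m)=1$ is understood to include $n\in W_\ell(m)$, and $H(n;m/d)\le d$ to include $n\in W(m/d)$. -}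

module Defs where

open import Algebra.Bundles.Raw using (RawRing)
import Algebra.Definitions.RawSemiring as RawSemiringOps
open import Data.Fin.Base using (Fin)
open import Data.Fin.Subset as Subset using (Subset)
import Data.Integer.Base as ℤ
open import Data.Nat.Base as ℕ using (ℕ; NonZero)
import Data.Nat.Properties as ℕ
open import Data.Nat.GCD using (gcd; gcd[m,n]≢0)
open import Data.Product.Base using (_×_; _,_; ∃-syntax)
open import Data.Rational.Base as ℚ using (ℚ; 0ℚ; 1ℚ; ½)
import Data.Rational.Properties as ℚ
open import Data.Rational.Solver using (module +-*-Solver)
open import Data.Sum.Base using (inj₁)
open import Data.Vec.Functional using (Vector)
open import Level using (0ℓ)
open import Relation.Binary.Core using (Rel)
open import Relation.Binary.PropositionalEquality
  using (_≡_; _≢_; refl; sym; trans; cong; cong₂; subst)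
open import Relation.Nullary.Negation using (¬_)
open import Relation.Unary using (Pred; _∈_)

------------------------------------------------------------------------
-- Real numbers: Cauchy sequences of rationals modulo null sequences.

-- Eventually P, i.e. for all sufficiently large indices.
Eventually : Pred ℕ 0ℓ → Set
Eventually P = ∃[ N ] (∀ i → N ℕ.≤ i → P i)

IsCauchy : (ℕ → ℚ) → Set
IsCauchy x = ∀ ε → 0ℚ ℚ.< ε →
  ∃[ N ] (∀ i j → N ℕ.≤ i → N ℕ.≤ j → ℚ.∣ x i ℚ.- x j ∣ ℚ.< ε)

record ℝ : Set where
  constructor mkℝ
  field
    seq      : ℕ → ℚ
    isCauchy : IsCauchy seq

open ℝ public

infix 4 _≈ᴿ_

_≈ᴿ_ : Rel ℝ 0ℓ
x ≈ᴿ y = ∀ ε → 0ℚ ℚ.< ε → Eventually (λ i → ℚ.∣ seq x i ℚ.- seq y i ∣ ℚ.< ε)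

-- The proofs below are opaque: normalising them makes type checking
-- prohibitively slow.

private opaque
  half-pos : ∀ {ε} → 0ℚ ℚ.< ε → 0ℚ ℚ.< ½ ℚ.* ε
  half-pos {ε} ε>0 =
    subst (ℚ._< ½ ℚ.* ε) (ℚ.*-zeroʳ ½) (ℚ.*-monoʳ-<-pos ½ ε>0)

private opaque
  half+half : ∀ ε → ½ ℚ.* ε ℚ.+ ½ ℚ.* ε ≡ ε
  half+half ε =
    trans (sym (ℚ.*-distribʳ-+ ε ½ ½)) (ℚ.*-identityˡ ε)

private opaque
  0<1 : 0ℚ ℚ.< 1ℚ
  0<1 = ℚ.positive⁻¹ 1ℚ

-- A Cauchy sequence is eventually bounded.
opaque
  bounded : ∀ x → IsCauchy x →
            ∃[ K ] (0ℚ ℚ.< K × Eventually (λ i → ℚ.∣ x i ∣ ℚ.< K))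
  bounded x cx with cx 1ℚ 0<1
  ... | N , tail = K , K>0 , N , x<K
    where
    open ℚ.≤-Reasoning
    K : ℚ
    K = 1ℚ ℚ.+ ℚ.∣ x N ∣

    K>0 : 0ℚ ℚ.< K
    K>0 = ℚ.+-mono-<-≤ 0<1 (ℚ.0≤∣p∣ (x N))

    x<K : ∀ i → N ℕ.≤ i → ℚ.∣ x i ∣ ℚ.< K
    x<K i N≤i = begin-strict
      ℚ.∣ x i ∣                             ≡⟨ cong ℚ.∣_∣ (split (x i) (x N)) ⟩
      ℚ.∣ (x i ℚ.- x N) ℚ.+ x N ∣           ≤⟨ ℚ.∣p+q∣≤∣p∣+∣q∣ (x i ℚ.- x N) (x N) ⟩
      ℚ.∣ x i ℚ.- x N ∣ ℚ.+ ℚ.∣ x N ∣       <⟨ ℚ.+-monoˡ-< ℚ.∣ x N ∣ (tail i N N≤i ℕ.≤-refl) ⟩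
      K                                     ∎
      where
      open +-*-Solver
      split : ∀ a b → a ≡ (a ℚ.- b) ℚ.+ b
      split = solve 2 (λ a b → a := (a :- b) :+ b) refl

private opaque
  const-cauchy : ∀ q → IsCauchy (λ _ → q)
  const-cauchy q ε ε>0 = 0 , λ _ _ _ _ →
    subst (λ r → ℚ.∣ r ∣ ℚ.< ε) (sym (ℚ.+-inverseʳ q)) ε>0

private opaque
  +-cauchy : ∀ x y → IsCauchy x → IsCauchy y → IsCauchy (λ i → x i ℚ.+ y i)
  +-cauchy x y cx cy ε ε>0
    with cx (½ ℚ.* ε) (half-pos ε>0) | cy (½ ℚ.* ε) (half-pos ε>0)
  ... | M , hx | N , hy = M ℕ.⊔ N , λ i j p q → begin-strict
    ℚ.∣ (x i ℚ.+ y i) ℚ.- (x j ℚ.+ y j) ∣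
      ≡⟨ cong ℚ.∣_∣ (regroup (x i) (y i) (x j) (y j)) ⟩
    ℚ.∣ (x i ℚ.- x j) ℚ.+ (y i ℚ.- y j) ∣
      ≤⟨ ℚ.∣p+q∣≤∣p∣+∣q∣ (x i ℚ.- x j) (y i ℚ.- y j) ⟩
    ℚ.∣ x i ℚ.- x j ∣ ℚ.+ ℚ.∣ y i ℚ.- y j ∣
      <⟨ ℚ.+-mono-< (hx i j (ℕ.m⊔n≤o⇒m≤o M N p) (ℕ.m⊔n≤o⇒m≤o M N q))
                    (hy i j (ℕ.m⊔n≤o⇒n≤o M N p) (ℕ.m⊔n≤o⇒n≤o M N q)) ⟩
    ½ ℚ.* ε ℚ.+ ½ ℚ.* ε
      ≡⟨ half+half ε ⟩
    ε ∎
    where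
    open ℚ.≤-Reasoning
    open +-*-Solver
    regroup : ∀ a b c d →
              (a ℚ.+ b) ℚ.- (c ℚ.+ d) ≡ (a ℚ.- c) ℚ.+ (b ℚ.- d)
    regroup = solve 4 (λ a b c d →
      (a :+ b) :- (c :+ d) := (a :- c) :+ (b :- d)) refl

private opaque
  neg-cauchy : ∀ x → IsCauchy x → IsCauchy (λ i → ℚ.- x i)
  neg-cauchy x cx ε ε>0 with cx ε ε>0
  ... | N , hx = N , λ i j p q →
    subst (ℚ._< ε)
      (trans (sym (ℚ.∣-p∣≡∣p∣ (x i ℚ.- x j))) (cong ℚ.∣_∣ (flip (x i) (x j))))
      (hx i j p q)
    where
    open +-*-Solver
    flip : ∀ a b → ℚ.- (a ℚ.- b) ≡ (ℚ.- a) ℚ.- (ℚ.- b)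
    flip = solve 2 (λ a b → :- (a :- b) := (:- a) :- (:- b)) refl

private opaque
  -- For K > 0, some δ > 0 satisfies K δ = ε / 2.
  shrink : ∀ K ε → 0ℚ ℚ.< K → 0ℚ ℚ.< ε → ∃[ δ ] (0ℚ ℚ.< δ × K ℚ.* δ ≡ ½ ℚ.* ε)
  shrink K ε K>0 ε>0 = K⁻¹ ℚ.* (½ ℚ.* ε) , δ>0 , Kδ≡ε/2
    where
    instance
      K-pos : ℚ.Positive K
      K-pos = ℚ.positive K>0
      K≢0 : ℚ.NonZero K
      K≢0 = ℚ.pos⇒nonZero K
      K⁻¹-pos : ℚ.Positive (ℚ.1/ K)
      K⁻¹-pos = ℚ.1/pos⇒pos K

    K⁻¹ : ℚ
    K⁻¹ = ℚ.1/ K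

    δ>0 : 0ℚ ℚ.< K⁻¹ ℚ.* (½ ℚ.* ε)
    δ>0 = subst (ℚ._< K⁻¹ ℚ.* (½ ℚ.* ε)) (ℚ.*-zeroʳ K⁻¹)
            (ℚ.*-monoʳ-<-pos K⁻¹ (half-pos ε>0))

    Kδ≡ε/2 : K ℚ.* (K⁻¹ ℚ.* (½ ℚ.* ε)) ≡ ½ ℚ.* ε
    Kδ≡ε/2 = trans (sym (ℚ.*-assoc K K⁻¹ (½ ℚ.* ε)))
               (trans (cong (ℚ._* (½ ℚ.* ε)) (ℚ.*-inverseʳ K))
                      (ℚ.*-identityˡ (½ ℚ.* ε)))

private opaque
  prod-≤ : ∀ a b {K δ} → 0ℚ ℚ.< K → ℚ.∣ a ∣ ℚ.< K → ℚ.∣ b ∣ ℚ.< δ →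
           ℚ.∣ a ℚ.* b ∣ ℚ.≤ K ℚ.* δ
  prod-≤ a b {K} {δ} K>0 a<K b<δ = begin
    ℚ.∣ a ℚ.* b ∣          ≡⟨ ℚ.∣p*q∣≡∣p∣*∣q∣ a b ⟩
    ℚ.∣ a ∣ ℚ.* ℚ.∣ b ∣    ≤⟨ ℚ.*-monoʳ-≤-nonNeg ℚ.∣ b ∣
                                {{ℚ.∣-∣-nonNeg b}} (ℚ.<⇒≤ a<K) ⟩
    K ℚ.* ℚ.∣ b ∣          ≤⟨ ℚ.*-monoˡ-≤-nonNeg K
                                {{ℚ.nonNegative (ℚ.<⇒≤ K>0)}} (ℚ.<⇒≤ b<δ) ⟩
    K ℚ.* δ                ∎
    where open ℚ.≤-Reasoning

private opaque
  prod-diff-≤ : ∀ a b c d {K L δ η ε} → 0ℚ ℚ.< K → 0ℚ ℚ.< L →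
                K ℚ.* δ ≡ ½ ℚ.* ε → L ℚ.* η ≡ ½ ℚ.* ε →
                ℚ.∣ a ∣ ℚ.< K → ℚ.∣ d ∣ ℚ.< L →
                ℚ.∣ b ℚ.- d ∣ ℚ.< δ → ℚ.∣ a ℚ.- c ∣ ℚ.< η →
                ℚ.∣ a ℚ.* b ℚ.- c ℚ.* d ∣ ℚ.≤ ε
  prod-diff-≤ a b c d {K} {L} {δ} {η} {ε} K>0 L>0 Kδ Lη a<K d<L bd<δ ac<η =
    begin
      ℚ.∣ a ℚ.* b ℚ.- c ℚ.* d ∣
        ≡⟨ cong ℚ.∣_∣ (regroup a b c d) ⟩
      ℚ.∣ a ℚ.* (b ℚ.- d) ℚ.+ d ℚ.* (a ℚ.- c) ∣
        ≤⟨ ℚ.∣p+q∣≤∣p∣+∣q∣ (a ℚ.* (b ℚ.- d)) (d ℚ.* (a ℚ.- c)) ⟩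
      ℚ.∣ a ℚ.* (b ℚ.- d) ∣ ℚ.+ ℚ.∣ d ℚ.* (a ℚ.- c) ∣
        ≤⟨ ℚ.+-mono-≤ (prod-≤ a (b ℚ.- d) K>0 a<K bd<δ)
                      (prod-≤ d (a ℚ.- c) L>0 d<L ac<η) ⟩
      K ℚ.* δ ℚ.+ L ℚ.* η
        ≡⟨ cong₂ ℚ._+_ Kδ Lη ⟩
      ½ ℚ.* ε ℚ.+ ½ ℚ.* ε
        ≡⟨ half+half ε ⟩
      ε ∎
    where
    open ℚ.≤-Reasoning
    open +-*-Solver
    regroup : ∀ a b c d →
              a ℚ.* b ℚ.- c ℚ.* d ≡ a ℚ.* (b ℚ.- d) ℚ.+ d ℚ.* (a ℚ.- c)
    regroup = solve 4 (λ a b c d →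
      a :* b :- c :* d := a :* (b :- d) :+ d :* (a :- c)) refl

private opaque
  half<whole : ∀ {ε} → 0ℚ ℚ.< ε → ½ ℚ.* ε ℚ.< ε
  half<whole {ε} ε>0 =
    subst (½ ℚ.* ε ℚ.<_) (ℚ.*-identityˡ ε)
      (ℚ.*-monoˡ-<-pos ε {{ℚ.positive ε>0}} ½<1)
    where
    ½<1 : ½ ℚ.< 1ℚ
    ½<1 = ℚ.*<* (ℤ.+<+ (ℕ.s≤s (ℕ.s≤s ℕ.z≤n)))

private opaque
  *-cauchy : ∀ x y → IsCauchy x → IsCauchy y → IsCauchy (λ i → x i ℚ.* y i)
  *-cauchy x y cx cy ε ε>0 =
    let K , K>0 , A , x<K = bounded x cx
        L , L>0 , B , y<L = bounded y cy
        δ , δ>0 , Kδ      = shrink K (½ ℚ.* ε) K>0 (half-pos ε>0)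
        η , η>0 , Lη      = shrink L (½ ℚ.* ε) L>0 (half-pos ε>0)
        C , hy            = cy δ δ>0
        D , hx            = cx η η>0
    in (A ℕ.⊔ B) ℕ.⊔ (C ℕ.⊔ D) , λ i j p q →
      let p₁ = ℕ.m⊔n≤o⇒m≤o (A ℕ.⊔ B) (C ℕ.⊔ D) p
          p₂ = ℕ.m⊔n≤o⇒n≤o (A ℕ.⊔ B) (C ℕ.⊔ D) p
          q₁ = ℕ.m⊔n≤o⇒m≤o (A ℕ.⊔ B) (C ℕ.⊔ D) q
          q₂ = ℕ.m⊔n≤o⇒n≤o (A ℕ.⊔ B) (C ℕ.⊔ D) q
      in ℚ.≤-<-trans
           (prod-diff-≤ (x i) (y i) (x j) (y j) K>0 L>0 Kδ Lη
              (x<K i (ℕ.m⊔n≤o⇒m≤o A B p₁)) (y<L j (ℕ.m⊔n≤o⇒n≤o A B q₁))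
              (hy i j (ℕ.m⊔n≤o⇒m≤o C D p₂) (ℕ.m⊔n≤o⇒m≤o C D q₂))
              (hx i j (ℕ.m⊔n≤o⇒n≤o C D p₂) (ℕ.m⊔n≤o⇒n≤o C D q₂)))
           (half<whole ε>0)

ℚ→ℝ : ℚ → ℝ
ℚ→ℝ q = mkℝ (λ _ → q) (const-cauchy q)

infixl 6 _+ᴿ_
infixl 7 _*ᴿ_
infix  8 -ᴿ_

_+ᴿ_ _*ᴿ_ : ℝ → ℝ → ℝ
-ᴿ_ : ℝ → ℝ

x +ᴿ y = mkℝ (λ i → seq x i ℚ.+ seq y i) (+-cauchy (seq x) (seq y) (isCauchy x) (isCauchy y))
x *ᴿ y = mkℝ (λ i → seq x i ℚ.* seq y i) (*-cauchy (seq x) (seq y) (isCauchy x) (isCauchy y))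
-ᴿ x = mkℝ (λ i → ℚ.- seq x i) (neg-cauchy (seq x) (isCauchy x))

------------------------------------------------------------------------
-- Complex numbers

record ℂ : Set where
  constructor _+i_
  field
    re im : ℝ

open ℂ public

ℂ-rawRing : RawRing 0ℓ 0ℓ
ℂ-rawRing = record
  { Carrier = ℂ
  ; _≈_     = λ z w → (re z ≈ᴿ re w) × (im z ≈ᴿ im w)
  ; _+_     = λ z w → (re z +ᴿ re w) +i (im z +ᴿ im w)
  ; _*_     = λ z w → (re z *ᴿ re w +ᴿ -ᴿ (im z *ᴿ im w))
                   +i (re z *ᴿ im w +ᴿ im z *ᴿ re w)
  ; -_      = λ z → (-ᴿ re z) +i (-ᴿ im z)
  ; 0#      = ℚ→ℝ 0ℚ +i ℚ→ℝ 0ℚ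
  ; 1#      = ℚ→ℝ 1ℚ +i ℚ→ℝ 0ℚ
  }

open RawRing ℂ-rawRing public
  using (_≈_)
  renaming (_+_ to _+ᶜ_; _*_ to _*ᶜ_; -_ to -ᶜ_; 0# to 0ᶜ; 1# to 1ᶜ)

open RawSemiringOps (RawRing.rawSemiring ℂ-rawRing) public
  using (sum; _^_)

------------------------------------------------------------------------
-- Vanishing sums of powers of roots of unity

Ω : ℕ → Pred ℂ 0ℓ
Ω k z = z ^ k ≈ 1ᶜ

-- x₁, …, xₙ are m-th roots of unity whose ℓ-th powers sum to zero.
Vanishing : ∀ {n} → ℕ → ℕ → Pred (Vector ℂ n) 0ℓ
Vanishing ℓ m x = (∀ i → x i ∈ Ω m) × sum (λ i → x i ^ ℓ) ≈ 0ᶜ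

W : ℕ → ℕ → Pred ℕ 0ℓ
W ℓ m n = 0 ℕ.< n × ∃[ x ] Vanishing {n} ℓ m x

-- Equality on ℂ is not decidable, so occurrences of a value v are not
-- counted directly: instead, every set of positions carrying v is small.
MultiplicityAtMost : ∀ {n} → ℕ → Pred (Vector ℂ n) 0ℓ
MultiplicityAtMost {n} h x =
  ∀ (v : ℂ) (S : Subset n) → (∀ i → i Subset.∈ S → x i ≈ v) → Subset.∣ S ∣ ℕ.≤ h

PairwiseDistinct : ∀ {n} → Pred (Vector ℂ n) 0ℓ
PairwiseDistinct x = ∀ i j → i ≢ j → ¬ (x i ≈ x j)

HasVanishing : (n ℓ m h : ℕ) → Set
HasVanishing n ℓ m h = ∃[ x ] (Vanishing {n} ℓ m x × MultiplicityAtMost h x)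

-- H(n; ℓ, m) is a partial function of n, defined for n ∈ W ℓ m only, hence
-- given by its graph: H[ n ⨾ ℓ , m ]≡ h.
record H[_⨾_,_]≡_ (n ℓ m h : ℕ) : Set where
  field
    defined  : n ∈ W ℓ m
    positive : 0 ℕ.< h
    attained : HasVanishing n ℓ m h
    minimal  : ∀ h′ → 0 ℕ.< h′ → HasVanishing n ℓ m h′ → h ℕ.≤ h′

H[_⨾_,_]≤_ : (n ℓ m k : ℕ) → Set
H[ n ⨾ ℓ , m ]≤ k = ∃[ h ] (H[ n ⨾ ℓ , m ]≡ h × h ℕ.≤ k)

instance
  gcd-nonZero : ∀ {m n} .{{_ : NonZero m}} → NonZero (gcd m n)
  gcd-nonZero {m} {n} =
    ℕ.≢-nonZero (gcd[m,n]≢0 m n (inj₁ (ℕ.≢-nonZero⁻¹ m)))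

{-# OPTIONS --safe #-}
module Submission where

-- Write m = k d and ℓ = l d with k and l coprime. The map x ↦ x^ℓ sends Ω_m to Ω_k, and its fibres
-- have exactly d elements: at most d since, by Bézout, x^m and x^ℓ determine x^d; at least d since for
-- a primitive m-th root ω the powers ω^(k t + e), t < d, all lie over ω^(ℓ e).
--
-- Equality on ℂ being undecidable, two further ingredients are needed.
--  * Primitive N-th roots exist. For t = tan θ let s_j be the imaginary part of (1 + i t)^j. All s_j with
--    j ≤ N are nonnegative at some small t > 0, but not at t = 2. At a boundary point c found by bisection,
--    s_N vanishes while the other s_j are at least c, so (1 + i c)² / (1 + c²) is a primitive N-th root.
--  * Numbers algebraic over ℚ are decidably zero: a relation α^r (q + α S) = 0 with q ≠ 0 decides whether
--    α = 0. Sums of powers of a root of unity are algebraic by linear dependence. So it is decidable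
--    whether a vanishing sum with given multiplicity bound exists, and the height can be found by search.

import Algebra.Definitions.RawMonoid as RawMonoid
open import Algebra.Bundles using (CommutativeRing)
import Algebra.Properties.CommutativeSemiring.Exp as Exp
import Algebra.Properties.Monoid.Sum as MonoidSum
import Algebra.Properties.Ring as RingProperties
import Algebra.Properties.Semiring.Sum as Sum
import Algebra.Solver.Ring as RingSolver
open import Algebra.Solver.Ring.AlmostCommutativeRing
  using (fromCommutativeRing; _-Raw-AlmostCommutative⟶_)
open import Data.Fin.Base as Fin
  using (Fin; zero; suc; toℕ; fromℕ<; combine; inject≤; punchIn; finToFun; funToFin)
import Data.Fin.Properties as Fin
open import Data.Fin.Subset as Subset using (Subset; ∣_∣; inside; outside; ⁅_⁆; _∪_)
import Data.Fin.Subset.Properties as Subset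
import Data.Integer.Base as ℤ
import Data.Integer.Properties as ℤ
open import Data.Maybe.Base as Maybe using (Maybe)
open import Data.Nat.Base as ℕ using (ℕ; zero; suc; NonZero; _≤_; _/_; z≤n; s≤s)
open import Data.Nat.Coprimality using (Coprime; coprime-Bézout; coprime-divisor; coprime-/gcd)
open import Data.Nat.Divisibility using (_∣_; ∣⇒≤; ∣1⇒≡1; m%n≡0⇒n∣m; *-cancelʳ-∣)
open import Data.Nat.DivMod using (_%_; m%n<n; m≡m%n+[m/n]*n; m/n*n≡m; m≥n⇒m/n>0)
open import Data.Nat.GCD using (gcd; gcd[m,n]∣m; gcd[m,n]∣n; module Bézout)
import Data.Nat.Properties as ℕ
import Data.Nat.Tactic.RingSolver as ℕSolver
open import Data.Product.Base using (_×_; _,_; proj₁; proj₂; ∃-syntax)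
open import Data.Rational.Base as ℚ using (ℚ; 0ℚ; 1ℚ; ½)
import Data.Rational.Properties as ℚ
open import Data.Rational.Solver using (module +-*-Solver)
open import Data.Rational.Unnormalised.Base as ℚᵘ using (mkℚᵘ)
import Data.Rational.Unnormalised.Properties as ℚᵘ
open import Data.Sum.Base using (_⊎_; inj₁; inj₂; [_,_]′)
open import Data.Vec.Base using (Vec; []; _∷_; here; there; replicate; tabulate)
open import Data.Vec.Functional using (Vector; tail; insertAt)
open import Data.Vec.Functional.Properties using (insertAt-lookup; insertAt-punchIn)
open import Data.Vec.Properties using (lookup∘tabulate; lookup⇒[]=; []=⇒lookup)
open import Function.Base using (_∘_)
open import Function.Bundles using (_⇔_; mk⇔)
open import Level using (0ℓ)
open import Relation.Binary.Definitions using (tri<; tri≈; tri>)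
open import Relation.Binary.PropositionalEquality as ≡
  using (_≡_; _≢_; cong; cong₂; subst; subst₂)
import Relation.Binary.Reasoning.Setoid as SetoidReasoning
open import Relation.Nullary.Decidable as Dec
  using (Dec; yes; no; does; ¬?; _×-dec_; decidable-stable; dec⇒maybe; dec-true; from-no)
open import Relation.Nullary.Negation using (¬_; contradiction)
open import Relation.Unary using (Pred; _∈_; Decidable)

-- Constructive fields

-- Decisions are needed for two purposes. The exponent of a given root of unity among the powers of
-- a primitive one is found by testing them all; and a height is a least value, so the claim that it
-- is at most d demands that it be computed. All that is used about ℂ beyond its being a commutative
-- ring containing ℚ are the axioms `stable`, `domain` and `local`. They all come from one dichotomy
-- for Cauchy sequences, `small⊎away`. The bisection watches every s_j, not s_N alone, because s_N
-- also vanishes at θ = aπ/N with a and N not coprime, where the resulting root of unity has smaller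
-- order. Normalising 1 + i c itself would require the square root of 1 + c²; its square, which
-- amounts to the quotient of 1 + i c by its conjugate, does not.

module ℚΣ = MonoidSum ℚ.+-0-monoid

-- The part of a discrete field of characteristic zero that holds constructively for ℂ.
record ConstructiveField : Set₁ where
  field
    commutativeRing : CommutativeRing 0ℓ 0ℓ
  open CommutativeRing commutativeRing public hiding (zero)
  field
    rationals : ℚ.+-*-rawRing -Raw-AlmostCommutative⟶ fromCommutativeRing commutativeRing
    stable    : ∀ x → ¬ ¬ x ≈ 0# → x ≈ 0#
    domain    : ∀ x y → x * y ≈ 0# → ¬ x ≈ 0# → y ≈ 0#
    -- The only axiom that concludes in a disjunction, hence the source of every decision about
    -- field elements.
    local     : ∀ x y → x + y ≈ 1# → ¬ x ≈ 0# ⊎ ¬ y ≈ 0#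

module FieldProperties (K : ConstructiveField) where

  open ConstructiveField K public
  open _-Raw-AlmostCommutative⟶_ rationals public renaming (⟦_⟧ to ι)
  open Exp commutativeSemiring public
  open Sum semiring public
  open RingProperties ring public
    using (x≈y⇒x∙y⁻¹≈ε; x∙y⁻¹≈ε⇒x≈y; -‿distribˡ-*; -0#≈0#; -‿+-comm)
  open SetoidReasoning setoid

  ι-cong : ∀ {p q} → p ≡ q → ι p ≈ ι q
  ι-cong = reflexive ∘ cong ι

  ι-≟ : ∀ p q → Maybe (ι p ≈ ι q)
  ι-≟ p q = Maybe.map ι-cong (dec⇒maybe (p ℚ.≟ q))

  open RingSolver ℚ.+-*-rawRing (fromCommutativeRing commutativeRing) rationals ι-≟
    using (solve; _:=_; _:+_; _:*_; _:-_; :-_; con)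

  1≉0 : ¬ 1# ≈ 0#
  1≉0 1≈0 with local 0# 0# (trans (+-identityˡ 0#) (sym 1≈0))
  ... | inj₁ ¬0≈0 = ¬0≈0 refl
  ... | inj₂ ¬0≈0 = ¬0≈0 refl

  x≈y⇒x-y≈0 : ∀ {x y} → x ≈ y → x - y ≈ 0#
  x≈y⇒x-y≈0 = x≈y⇒x∙y⁻¹≈ε

  x-y≈0⇒x≈y : ∀ {x y} → x - y ≈ 0# → x ≈ y
  x-y≈0⇒x≈y = x∙y⁻¹≈ε⇒x≈y _ _

  -- The monic polynomial whose lower coefficients, constant term first, are listed.
  monic : ∀ {n} → Vec Carrier n → Carrier → Carrier
  monic []      x = 1#
  monic (a ∷ p) x = a + x * monic p x

  -- Horner's scheme: the coefficients of (p(x) - p(r)) / (x - r) are the values at r of the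
  -- successive tails of p.
  quotient : ∀ {n} → Vec Carrier (suc n) → Carrier → Vec Carrier n
  quotient (a ∷ [])        r = []
  quotient (a ∷ p@(_ ∷ _)) r = monic p r ∷ quotient p r

  monic-diff : ∀ {n} (p : Vec Carrier (suc n)) r x →
               monic p x - monic p r ≈ (x - r) * monic (quotient p r) x
  monic-diff (a ∷ []) r x =
    solve 4 (λ a x r u → (a :+ x :* u) :- (a :+ r :* u) := (x :- r) :* u) refl a x r 1#
  monic-diff (a ∷ p@(_ ∷ _)) r x = begin
    (a + x * monic p x) - (a + r * monic p r)
      ≈⟨ solve 5 (λ a x r s t → (a :+ x :* s) :- (a :+ r :* t) := x :* (s :- t) :+ (x :- r) :* t) refl
           a x r (monic p x) (monic p r) ⟩
    x * (monic p x - monic p r) + (x - r) * monic p r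
      ≈⟨ +-congʳ (*-congˡ (monic-diff p r x)) ⟩
    x * ((x - r) * monic (quotient p r) x) + (x - r) * monic p r
      ≈⟨ solve 4 (λ x r q t → x :* ((x :- r) :* q) :+ (x :- r) :* t := (x :- r) :* (t :+ x :* q)) refl
           x r (monic (quotient p r) x) (monic p r) ⟩
    (x - r) * (monic p r + x * monic (quotient p r) x) ∎

  Distinct : ∀ {n} → Vector Carrier n → Set
  Distinct r = ∀ i j → i ≢ j → ¬ r i ≈ r j

  -- Dividing by x - r₀ lowers the degree and keeps the remaining roots: `domain` cancels the factor
  -- r_i - r₀, which is nonzero by distinctness.
  monic-roots : ∀ {n} (p : Vec Carrier n) (r : Vector Carrier (suc n)) →
                Distinct r → ¬ (∀ i → monic p (r i) ≈ 0#)
  monic-roots []        r distinct root = 1≉0 (root zero)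
  monic-roots p@(_ ∷ _) r distinct root = monic-roots (quotient p (r zero)) (tail r)
    (λ i j i≢j → distinct (suc i) (suc j) (i≢j ∘ Fin.suc-injective))
    (λ i → domain (r (suc i) - r zero) _
      (begin
        (r (suc i) - r zero) * monic (quotient p (r zero)) (r (suc i))
          ≈⟨ monic-diff p (r zero) (r (suc i)) ⟨
        monic p (r (suc i)) - monic p (r zero)
          ≈⟨ x≈y⇒x-y≈0 (trans (root (suc i)) (sym (root zero))) ⟩
        0# ∎)
      (distinct (suc i) zero (λ ()) ∘ x-y≈0⇒x≈y))

  ^-roots : ∀ n .{{_ : NonZero n}} c (r : Vector Carrier (suc n)) →
            Distinct r → ¬ (∀ i → r i ^ n ≈ c)
  ^-roots (suc n) c r distinct root =
    monic-roots (- c ∷ replicate n 0#) r distinct λ i → begin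
      - c + r i * monic (replicate n 0#) (r i)  ≈⟨ +-congˡ (*-congˡ (monic-0 n (r i))) ⟩
      - c + r i ^ suc n                         ≈⟨ +-congˡ (root i) ⟩
      - c + c                                   ≈⟨ -‿inverseˡ c ⟩
      0#                                        ∎
    where
    monic-0 : ∀ n x → monic (replicate n 0#) x ≈ x ^ n
    monic-0 zero    x = refl
    monic-0 (suc n) x = trans (+-identityˡ _) (*-congˡ (monic-0 n x))

  -- Linear dependence over ℚ

  combination : ∀ {k} → Vector ℚ k → Vector Carrier k → Carrier
  combination a v = sum (λ l → ι (a l) * v l)

  -- The coefficients are kept as rational data, for which being zero is decidable, so that
  -- elimination can search for a pivot.
  record Span {k} (v : Vector Carrier k) (z : Carrier) : Set where
    constructor _,_
    field
      coefficients : Vector ℚ k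
      expansion    : z ≈ combination coefficients v

  open Span

  module _ {k} {v : Vector Carrier k} where

    Span-resp : ∀ {z w} → z ≈ w → Span v z → Span v w
    Span-resp z≈w (a , e) = a , trans (sym z≈w) e

    Span-0 : Span v 0#
    Span-0 = (λ _ → 0ℚ) , sym (trans
      (sum-cong-≋ (λ l → trans (*-congʳ 0-homo) (zeroˡ (v l)))) (sum-replicate-zero k))

    Span-+ : ∀ {z w} → Span v z → Span v w → Span v (z + w)
    Span-+ {z} {w} (a , e) (b , f) = (λ l → a l ℚ.+ b l) , (begin
      z + w
        ≈⟨ +-cong e f ⟩
      combination a v + combination b v
        ≈⟨ ∑-distrib-+ (λ l → ι (a l) * v l) (λ l → ι (b l) * v l) ⟨
      sum (λ l → ι (a l) * v l + ι (b l) * v l)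
        ≈⟨ sum-cong-≋ (λ l → trans (*-congʳ (+-homo (a l) (b l))) (distribʳ (v l) _ _)) ⟨
      combination (λ l → a l ℚ.+ b l) v ∎)

    Span-ι* : ∀ q {z} → Span v z → Span v (ι q * z)
    Span-ι* q {z} (a , e) = (λ l → q ℚ.* a l) , (begin
      ι q * z                                ≈⟨ *-congˡ e ⟩
      ι q * combination a v                  ≈⟨ *-distribˡ-sum (ι q) (λ l → ι (a l) * v l) ⟩
      sum (λ l → ι q * (ι (a l) * v l))
        ≈⟨ sum-cong-≋ (λ l → trans (*-congʳ (*-homo q (a l))) (*-assoc _ _ _)) ⟨
      combination (λ l → q ℚ.* a l) v        ∎)

    Span-sum : ∀ {n} {f : Vector Carrier n} → (∀ i → Span v (f i)) → Span v (sum f)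
    Span-sum {zero}  h = Span-0
    Span-sum {suc n} h = Span-+ (h zero) (Span-sum (h ∘ suc))

  Span-suc : ∀ {k} (v : Vector Carrier (suc k)) {z} → Span (tail v) z → Span v z
  Span-suc v (a , e) = (λ { zero → 0ℚ ; (suc l) → a l }) ,
    trans e (sym (trans (+-congʳ (trans (*-congʳ 0-homo) (zeroˡ (v zero)))) (+-identityˡ _)))

  Span-generator : ∀ {k} (v : Vector Carrier k) l → Span v (v l)
  Span-generator v zero = (λ { zero → 1ℚ ; (suc _) → 0ℚ }) , sym (begin
    ι 1ℚ * v zero + sum (λ l → ι 0ℚ * v (suc l))
      ≈⟨ +-cong (trans (*-congʳ 1-homo) (*-identityˡ _)) (sym (expansion (Span-0 {v = tail v}))) ⟩
    v zero + 0#
      ≈⟨ +-identityʳ _ ⟩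
    v zero ∎)
  Span-generator v (suc l) = Span-suc v (Span-generator (tail v) l)

  Span-* : ∀ {k} {v : Vector Carrier k} → (∀ i j → Span v (v i * v j)) →
           ∀ {z w} → Span v z → Span v w → Span v (z * w)
  Span-* {v = v} closed {z} {w} (a , e) (b , f) = Span-resp
    (sym (trans (*-congʳ e) (*-distribʳ-sum w (λ i → ι (a i) * v i))))
    (Span-sum λ i → Span-resp (sym (*-assoc (ι (a i)) (v i) w)) (Span-ι* (a i) (Span-resp
      (sym (trans (*-congˡ f) (*-distribˡ-sum (v i) (λ j → ι (b j) * v j))))
      (Span-sum λ j → Span-resp
        (solve 3 (λ q x y → q :* (x :* y) := x :* (q :* y)) refl (ι (b j)) (v i) (v j))
        (Span-ι* (b j) (closed i j))))))

  Nontrivial : ∀ {k} → Vector ℚ k → Set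
  Nontrivial c = ∃[ j ] c j ≢ 0ℚ

  ι-sum : ∀ {n} (c : Vector ℚ n) → ι (ℚΣ.sum c) ≈ sum (ι ∘ c)
  ι-sum {zero}  c = 0-homo
  ι-sum {suc n} c = trans (+-homo _ _) (+-congˡ (ι-sum (tail c)))

  -- Gaussian elimination: a vector with nonzero first coordinate is used to clear the first
  -- coordinate of all the others.
  linear-dependence : ∀ {k} (v : Vector Carrier k) (w : Vector Carrier (suc k)) →
                      (∀ j → Span v (w j)) → ∃[ c ] (Nontrivial c × combination c w ≈ 0#)
  linear-dependence {zero} v w h = (λ _ → 1ℚ) , (zero , λ ()) ,
    trans (+-identityʳ _) (trans (*-congˡ (expansion (h zero))) (zeroʳ _))
  linear-dependence {suc k} v w h with Fin.any? (λ j → ¬? (coefficients (h j) zero ℚ.≟ 0ℚ))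
  -- Without a pivot, `v zero` contributes to none of the vectors; it is dropped, and one vector
  -- with it, so that there is still one vector more than generators.
  ... | no all-0 =
    let c , (j , cⱼ≢0) , e = linear-dependence (tail v) (tail w) (λ j →
          let (a , f) = h (suc j) in tail a , trans f (trans
            (+-congʳ (trans (*-congʳ (trans (ι-cong
              (decidable-stable (a zero ℚ.≟ 0ℚ) (λ a≢0 → all-0 (suc j , a≢0)))) 0-homo)) (zeroˡ _)))
            (+-identityˡ _)))
    in (λ { zero → 0ℚ ; (suc j) → c j }) , (suc j , cⱼ≢0) ,
       trans (+-cong (trans (*-congʳ 0-homo) (zeroˡ _)) e) (+-identityˡ _)
  ... | yes (p , aₚ≢0) =
    let c , (j , cⱼ≢0) , e = linear-dependence (tail v) cleared cleared-Span
        -- The coefficient of the pivot vector `w p`, collecting the multiples of it that were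
        -- subtracted in `cleared`.
        s = ℚ.- ℚΣ.sum (λ j → c j ℚ.* q j)
        s-expansion = begin
          ι s * w p
            ≈⟨ *-congʳ (trans (-‿homo _) (-‿cong (ι-sum (λ j → c j ℚ.* q j)))) ⟩
          (- sum (λ j → ι (c j ℚ.* q j))) * w p
            ≈⟨ *-congʳ (trans (sum-neg (λ j → ι (c j ℚ.* q j)))
                 (sum-cong-≋ (λ j → -‿cong (*-homo (c j) (q j))))) ⟩
          sum (λ j → - (ι (c j) * ι (q j))) * w p
            ≈⟨ *-distribʳ-sum (w p) (λ j → - (ι (c j) * ι (q j))) ⟩
          sum (λ j → (- (ι (c j) * ι (q j))) * w p) ∎
    in insertAt c p s , (punchIn p j , cⱼ≢0 ∘ ≡.trans (≡.sym (insertAt-punchIn c p s j))) , (begin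
      combination (insertAt c p s) w
        ≈⟨ sum-remove {i = p} (λ j → ι (insertAt c p s j) * w j) ⟩
      ι (insertAt c p s p) * w p + sum (λ j → ι (insertAt c p s (punchIn p j)) * w (punchIn p j))
        ≈⟨ +-cong (*-congʳ (ι-cong (insertAt-lookup c p s)))
             (sum-cong-≋ (λ j → *-congʳ {w (punchIn p j)} (ι-cong (insertAt-punchIn c p s j)))) ⟩
      ι s * w p + sum (λ j → ι (c j) * w (punchIn p j))
        ≈⟨ +-congʳ s-expansion ⟩
      sum (λ j → (- (ι (c j) * ι (q j))) * w p) + sum (λ j → ι (c j) * w (punchIn p j))
        ≈⟨ ∑-distrib-+ (λ j → (- (ι (c j) * ι (q j))) * w p) (λ j → ι (c j) * w (punchIn p j)) ⟨
      sum (λ j → (- (ι (c j) * ι (q j))) * w p + ι (c j) * w (punchIn p j))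
        ≈⟨ sum-cong-≋ (λ j → trans
             (solve 4 (λ c q x y → (:- (c :* q)) :* y :+ c :* x := c :* (x :+ :- q :* y)) refl
               (ι (c j)) (ι (q j)) (w (punchIn p j)) (w p))
             (*-congˡ (+-congˡ (*-congʳ (sym (-‿homo (q j))))))) ⟩
      combination c cleared
        ≈⟨ e ⟩
      0# ∎)
    where
    a : Fin (suc (suc k)) → Vector ℚ (suc k)
    a j = coefficients (h j)
    instance
      _ = ℚ.≢-nonZero aₚ≢0
    q : Vector ℚ (suc k)
    q j = a (punchIn p j) zero ℚ.* ℚ.1/ a p zero
    cleared : Vector Carrier (suc k)
    cleared j = w (punchIn p j) + ι (ℚ.- q j) * w p
    sum-neg : ∀ {n} (f : Vector Carrier n) → - sum f ≈ sum (λ i → - f i)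
    sum-neg {zero}  f = -0#≈0#
    sum-neg {suc n} f = trans (sym (-‿+-comm _ _)) (+-congˡ (sum-neg (tail f)))
    cleared-Span : ∀ j → Span (tail v) (cleared j)
    cleared-Span j =
      let (b , e) = Span-+ (h (punchIn p j)) (Span-ι* (ℚ.- q j) (h p))
      in tail b , trans e (trans (+-congʳ (trans (*-congʳ (trans (ι-cong b₀≡0) 0-homo)) (zeroˡ _)))
                    (+-identityˡ _))
      where
      b₀≡0 : a (punchIn p j) zero ℚ.+ ℚ.- q j ℚ.* a p zero ≡ 0ℚ
      b₀≡0 = ≡R.begin
        x ℚ.+ ℚ.- (x ℚ.* y⁻¹) ℚ.* y  ≡R.≡⟨ cong (x ℚ.+_) (≡.sym (ℚ.neg-distribˡ-* (x ℚ.* y⁻¹) y)) ⟩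
        x ℚ.- x ℚ.* y⁻¹ ℚ.* y        ≡R.≡⟨ cong (λ u → x ℚ.- u) (ℚ.*-assoc x y⁻¹ y) ⟩
        x ℚ.- x ℚ.* (y⁻¹ ℚ.* y)      ≡R.≡⟨ cong (λ u → x ℚ.- x ℚ.* u) (ℚ.*-inverseˡ y) ⟩
        x ℚ.- x ℚ.* 1ℚ               ≡R.≡⟨ cong (λ u → x ℚ.- u) (ℚ.*-identityʳ x) ⟩
        x ℚ.- x                      ≡R.≡⟨ ℚ.+-inverseʳ x ⟩
        0ℚ                           ≡R.∎
        where
        module ≡R = ≡.≡-Reasoning
        x = a (punchIn p j) zero
        y = a p zero
        y⁻¹ = ℚ.1/ y

  -- Deciding whether an algebraic number vanishes

  nilpotent : ∀ n {x} → x ^ n ≈ 0# → x ≈ 0#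
  nilpotent n {x} xⁿ≈0 = stable x (λ ¬x≈0 → go ¬x≈0 n xⁿ≈0)
    where
    go : ¬ x ≈ 0# → ∀ n → ¬ x ^ n ≈ 0#
    go ¬x≈0 zero    e = 1≉0 e
    go ¬x≈0 (suc n) e = go ¬x≈0 n (domain x (x ^ n) e ¬x≈0)

  evaluate : ∀ {n} → Vector ℚ n → Carrier → Carrier
  evaluate c α = combination c (λ j → α ^ toℕ j)

  evaluate-suc : ∀ {n} (c : Vector ℚ (suc n)) α →
                 evaluate c α ≈ ι (c zero) + α * evaluate (tail c) α
  evaluate-suc c α = +-cong (*-identityʳ _) (trans
    (sum-cong-≋ (λ j → solve 3 (λ q a b → q :* (a :* b) := a :* (q :* b)) refl
      (ι (c (suc j))) α (α ^ toℕ j)))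
    (sym (*-distribˡ-sum α (λ j → ι (c (suc j)) * α ^ toℕ j))))

  -- If c₀ is the lowest nonzero coefficient, the relation reads α^r (c₀ + α S) = 0, and the two
  -- summands of c₀ = (c₀ + α S) - α S cannot both vanish.
  algebraic-dec : ∀ {n} (c : Vector ℚ n) r {α} → Nontrivial c →
                  α ^ r * evaluate c α ≈ 0# → Dec (α ≈ 0#)
  algebraic-dec {suc n} c r {α} (j , cⱼ≢0) e with c zero ℚ.≟ 0ℚ
  ... | yes c₀≡0 = algebraic-dec (tail c) (suc r) (nontrivial-tail j cⱼ≢0) (begin
    α ^ suc r * S
      ≈⟨ solve 3 (λ a b s → a :* b :* s := b :* (a :* s)) refl α (α ^ r) S ⟩
    α ^ r * (α * S)
      ≈⟨ *-congˡ (trans (evaluate-suc c α) (trans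
           (+-congʳ (trans (ι-cong c₀≡0) 0-homo)) (+-identityˡ _))) ⟨
    α ^ r * evaluate c α
      ≈⟨ e ⟩
    0# ∎)
    where
    S = evaluate (tail c) α
    nontrivial-tail : ∀ j → c j ≢ 0ℚ → Nontrivial (tail c)
    nontrivial-tail zero    c₀≢0 = contradiction c₀≡0 c₀≢0
    nontrivial-tail (suc j) cⱼ≢0 = j , cⱼ≢0
  -- If the first summand is nonzero, so is T, and α^r T = 0 leaves α^r = 0; if the second is
  -- nonzero, so is its factor α.
  ... | no c₀≢0 = [ (λ ¬uT≈0 → yes (nilpotent r (domain T (α ^ r) (trans (*-comm T (α ^ r)) e)
                      (λ T≈0 → ¬uT≈0 (trans (*-congˡ T≈0) (zeroʳ u)))))) ,
                    (λ ¬uSα≈0 → no (λ α≈0 → ¬uSα≈0 (trans (*-congˡ α≈0) (zeroʳ (- (u * S)))))) ]′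
                  (local (u * T) (- (u * S) * α) split)
    where
    instance
      _ = ℚ.≢-nonZero c₀≢0
    u = ι (ℚ.1/ c zero)
    S = evaluate (tail c) α
    T = evaluate c α
    split : u * T + - (u * S) * α ≈ 1#
    split = begin
      u * T + - (u * S) * α
        ≈⟨ +-congʳ (*-congˡ (evaluate-suc c α)) ⟩
      u * (ι (c zero) + α * S) + - (u * S) * α
        ≈⟨ solve 4 (λ u q a s → u :* (q :+ a :* s) :+ (:- (u :* s)) :* a := u :* q) refl
             u (ι (c zero)) α S ⟩
      u * ι (c zero)
        ≈⟨ trans (sym (*-homo _ _)) (trans (ι-cong (ℚ.*-inverseˡ (c zero))) 1-homo) ⟩
      1# ∎

  sum-^1 : ∀ {n} (x : Vector Carrier n) → sum (λ i → x i ^ 1) ≈ sum x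
  sum-^1 x = sum-cong-≋ (λ i → *-identityʳ (x i))

  sum-^1≈0⇒ : ∀ {n} (x : Vector Carrier n) → sum (λ i → x i ^ 1) ≈ 0# → sum x ≈ 0#
  sum-^1≈0⇒ x = trans (sym (sum-^1 x))

  sum-^1≈0⇐ : ∀ {n} (x : Vector Carrier n) → sum x ≈ 0# → sum (λ i → x i ^ 1) ≈ 0#
  sum-^1≈0⇐ x = trans (sum-^1 x)

  1^n≈1 : ∀ n → 1# ^ n ≈ 1#
  1^n≈1 zero    = refl
  1^n≈1 (suc n) = trans (*-identityˡ _) (1^n≈1 n)

  root-^ : ∀ k {u} → u ^ k ≈ 1# → ∀ n → (u ^ n) ^ k ≈ 1#
  root-^ k {u} uᵏ≈1 n = begin
    (u ^ n) ^ k      ≈⟨ ^-assocʳ u n k ⟩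
    u ^ (n ℕ.* k)    ≈⟨ ^-congʳ u (ℕ.*-comm n k) ⟩
    u ^ (k ℕ.* n)    ≈⟨ ^-assocʳ u k n ⟨
    (u ^ k) ^ n      ≈⟨ ^-congˡ n uᵏ≈1 ⟩
    1# ^ n           ≈⟨ 1^n≈1 n ⟩
    1#               ∎

  ^-multiple : ∀ k {u} → u ^ k ≈ 1# → ∀ j → u ^ (j ℕ.* k) ≈ 1#
  ^-multiple k {u} uᵏ≈1 j = trans (sym (^-assocʳ u j k)) (root-^ k uᵏ≈1 j)

  root-nonzero : ∀ k .{{_ : NonZero k}} {u} → u ^ k ≈ 1# → ¬ u ≈ 0#
  root-nonzero (suc k) uᵏ≈1 u≈0 = 1≉0 (trans (sym uᵏ≈1) (trans (*-congʳ u≈0) (zeroˡ _)))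

  module _ {u k} .{{_ : NonZero k}} (uᵏ≈1 : u ^ k ≈ 1#) where

    powers : Vector Carrier k
    powers l = u ^ toℕ l

    Span-power : ∀ j → Span powers (u ^ j)
    Span-power j = Span-resp (begin
      u ^ toℕ (fromℕ< (m%n<n j k))       ≈⟨ ^-congʳ u (Fin.toℕ-fromℕ< (m%n<n j k)) ⟩
      u ^ (j % k)                        ≈⟨ *-identityʳ _ ⟨
      u ^ (j % k) * 1#                   ≈⟨ *-congˡ (^-multiple k uᵏ≈1 (j / k)) ⟨
      u ^ (j % k) * u ^ (j / k ℕ.* k)    ≈⟨ ^-homo-* u (j % k) _ ⟨
      u ^ (j % k ℕ.+ j / k ℕ.* k)        ≈⟨ ^-congʳ u (m≡m%n+[m/n]*n j k) ⟨
      u ^ j                              ∎)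
      (Span-generator powers (fromℕ< (m%n<n j k)))

    -- The span is closed under products, so the k + 1 powers 1, α, ..., α^k all lie in the span of
    -- k elements. Their linear dependence is a nonzero rational polynomial vanishing at α.
    Span-powers-dec : ∀ {α} → Span powers α → Dec (α ≈ 0#)
    Span-powers-dec {α} α∈ =
      let c , nontrivial , e = linear-dependence powers (λ j → α ^ toℕ j) (λ j → ^-Span (toℕ j))
      in algebraic-dec c 0 nontrivial (trans (*-identityˡ _) e)
      where
      ^-Span : ∀ j → Span powers (α ^ j)
      ^-Span zero    = Span-power 0
      ^-Span (suc j) = Span-* (λ i j → Span-resp (^-homo-* u (toℕ i) (toℕ j))
        (Span-power (toℕ i ℕ.+ toℕ j))) α∈ (^-Span j)

    sum-powers-dec : ∀ {n} (e : Fin n → ℕ) → Dec (sum (λ i → u ^ e i) ≈ 0#)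
    sum-powers-dec e = Span-powers-dec (Span-sum (Span-power ∘ e))

  -- The difference z - w would involve two roots of unity. The quotient u = z / w, with w⁻¹ a power
  -- of w, is a single one, and u - 1 lies in the span of its powers.
  roots-≈-dec : ∀ k .{{_ : NonZero k}} {z w} → z ^ k ≈ 1# → w ^ k ≈ 1# → Dec (z ≈ w)
  roots-≈-dec (suc k) {z} {w} zᵏ≈1 wᵏ≈1 = Dec.map′
    (λ u-1≈0 → begin
      z                   ≈⟨ *-identityʳ z ⟨
      z * 1#              ≈⟨ *-congˡ wᵏ≈1 ⟨
      z * (w * w ^ k)     ≈⟨ solve 3 (λ a b c → a :* (b :* c) := (a :* c) :* b) refl z w (w ^ k) ⟩
      u * w               ≈⟨ *-congʳ (x-y≈0⇒x≈y u-1≈0) ⟩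
      1# * w              ≈⟨ *-identityˡ w ⟩
      w                   ∎)
    (λ z≈w → x≈y⇒x-y≈0 (trans (*-congʳ z≈w) wᵏ≈1))
    (Span-powers-dec uᵏ≈1 {u - 1#} (Span-+
      (Span-resp (*-identityʳ u) (Span-power uᵏ≈1 1))
      (Span-resp (trans (*-congʳ (trans (-‿homo 1ℚ) (-‿cong 1-homo)))
          (trans (sym (-‿distribˡ-* _ _)) (-‿cong (*-identityˡ 1#))))
        (Span-ι* (ℚ.- 1ℚ) (Span-power uᵏ≈1 0)))))
    where
    u = z * w ^ k
    uᵏ≈1 : u ^ suc k ≈ 1#
    uᵏ≈1 = trans (^-distrib-* z (w ^ k) (suc k))
      (trans (*-cong zᵏ≈1 (root-^ (suc k) wᵏ≈1 k)) (*-identityˡ 1#))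

  -- Primitive roots of unity

  Primitive : ℕ → Pred Carrier 0ℓ
  Primitive k ω = ω ^ k ≈ 1# × (∀ j → 0 ℕ.< j → j ℕ.< k → ¬ ω ^ j ≈ 1#)

  private
    Primitive-< : ∀ {ω k i j} → Primitive k ω → i ℕ.< j → j ℕ.< k → ¬ ω ^ i ≈ ω ^ j
    Primitive-< {ω} {k} {i} {j} (ωᵏ≈1 , minimal) i<j j<k e =
      minimal (j ℕ.∸ i) (ℕ.m<n⇒0<n∸m i<j) (ℕ.≤-<-trans (ℕ.m∸n≤m j i) j<k)
        (x-y≈0⇒x≈y (domain (ω ^ i) _ (begin
          ω ^ i * (ω ^ (j ℕ.∸ i) - 1#)
            ≈⟨ solve 3 (λ a b c → a :* (b :- c) := a :* b :- a :* c) refl (ω ^ i) _ 1# ⟩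
          ω ^ i * ω ^ (j ℕ.∸ i) - ω ^ i * 1#
            ≈⟨ +-cong (sym (^-homo-* ω i _)) (-‿cong (*-identityʳ _)) ⟩
          ω ^ (i ℕ.+ (j ℕ.∸ i)) - ω ^ i
            ≈⟨ +-congʳ (^-congʳ ω (ℕ.m+[n∸m]≡n (ℕ.<⇒≤ i<j))) ⟩
          ω ^ j - ω ^ i
            ≈⟨ x≈y⇒x-y≈0 (sym e) ⟩
          0# ∎)
        (root-nonzero k {{ℕ.>-nonZero (ℕ.≤-<-trans ℕ.z≤n j<k)}} (root-^ k ωᵏ≈1 i))))

  Primitive-injective : ∀ {ω k i j} → Primitive k ω → i ℕ.< k → j ℕ.< k → ω ^ i ≈ ω ^ j → i ≡ j
  Primitive-injective {ω} {k} {i} {j} prim i<k j<k e with ℕ.<-cmp i j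
  ... | tri< i<j _ _ = contradiction e (Primitive-< prim i<j j<k)
  ... | tri≈ _ i≡j _ = i≡j
  ... | tri> _ _ j<i = contradiction (sym e) (Primitive-< prim j<i i<k)

  -- If the search through the k powers of ω fails, z together with them gives k + 1 distinct roots
  -- of X^k - 1.
  Primitive-generates : ∀ {ω k z} .{{_ : NonZero k}} → Primitive k ω → z ^ k ≈ 1# →
                        ∃[ j ] z ≈ ω ^ toℕ {k} j
  Primitive-generates {ω} {k} {z} prim zᵏ≈1
    with Fin.any? {k} (λ j → roots-≈-dec k zᵏ≈1 (root-^ k (proj₁ prim) (toℕ j)))
  ... | yes found = found
  ... | no ¬found = contradiction root (^-roots k 1# r distinct)
    where
    r : Vector Carrier (suc k)
    r zero    = z
    r (suc j) = ω ^ toℕ j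
    distinct : Distinct r
    distinct zero    zero    i≢j e = i≢j ≡.refl
    distinct zero    (suc j) _   e = ¬found (j , e)
    distinct (suc i) zero    _   e = ¬found (i , sym e)
    distinct (suc i) (suc j) i≢j e = i≢j (cong suc (Fin.toℕ-injective
      (Primitive-injective prim (Fin.toℕ<n i) (Fin.toℕ<n j) e)))
    root : ∀ i → r i ^ k ≈ 1#
    root zero    = zᵏ≈1
    root (suc j) = root-^ k (proj₁ prim) (toℕ j)

  Primitive-∣ : ∀ {ω k} n .{{_ : NonZero k}} → Primitive k ω → ω ^ n ≈ 1# → k ∣ n
  Primitive-∣ {ω} {k} n (ωᵏ≈1 , minimal) ωⁿ≈1 with n % k ℕ.≟ 0
  ... | yes n%k≡0 = m%n≡0⇒n∣m n k n%k≡0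
  ... | no  n%k≢0 = contradiction (begin
    ω ^ (n % k)                        ≈⟨ *-identityʳ _ ⟨
    ω ^ (n % k) * 1#                   ≈⟨ *-congˡ (^-multiple k ωᵏ≈1 (n / k)) ⟨
    ω ^ (n % k) * ω ^ (n / k ℕ.* k)    ≈⟨ ^-homo-* ω (n % k) _ ⟨
    ω ^ (n % k ℕ.+ n / k ℕ.* k)        ≈⟨ ^-congʳ ω (m≡m%n+[m/n]*n n k) ⟨
    ω ^ n                              ≈⟨ ωⁿ≈1 ⟩
    1#                                 ∎)
    (minimal (n % k) (ℕ.n≢0⇒n>0 n%k≢0) (m%n<n n k))

  -- If the j-th power of ω^(l d) is 1, then k d divides l d j, so k divides l j and, by
  -- coprimality, j.
  Primitive-power : ∀ {ω} k l d .{{_ : NonZero k}} .{{_ : NonZero d}} → Coprime k l →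
                    Primitive (k ℕ.* d) ω → Primitive k (ω ^ (l ℕ.* d))
  Primitive-power {ω} k l d k⊥l prim = trans (^-assocʳ ω (l ℕ.* d) k)
    (trans (^-congʳ ω (lemma k)) (^-multiple (k ℕ.* d) (proj₁ prim) l)) ,
    λ j 0<j j<k e → ℕ.<⇒≱ j<k (∣⇒≤ {{ℕ.>-nonZero 0<j}} (coprime-divisor k⊥l
      (*-cancelʳ-∣ d (subst (k ℕ.* d ∣_) (≡.trans (lemma j) (≡.sym (ℕ.*-assoc l j d)))
        (Primitive-∣ (l ℕ.* d ℕ.* j) {{ℕ.m*n≢0 k d}} prim
          (trans (sym (^-assocʳ ω (l ℕ.* d) j)) e))))))
    where
    lemma : ∀ j → l ℕ.* d ℕ.* j ≡ l ℕ.* (j ℕ.* d)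
    lemma j = ≡.trans (ℕ.*-assoc l d j) (cong (l ℕ.*_) (ℕ.*-comm d j))

  -- With r inverse to u v, the product `u * u * r` is u / v, so its j-th power is 1 exactly when
  -- u^j = v^j. For u = 1 + i c and v its conjugate, this says that u^j is real.
  module _ u v r (uvr≈1 : u * v * r ≈ 1#) where

    private
      square-quotient : ∀ j → (u * u * r) ^ j * v ^ j ≈ u ^ j
      square-quotient j = begin
        (u * u * r) ^ j * v ^ j   ≈⟨ ^-distrib-* (u * u * r) v j ⟨
        (u * u * r * v) ^ j       ≈⟨ ^-congˡ j (solve 3 (λ u v r → u :* u :* r :* v := u :* (u :* v :* r)) refl u v r) ⟩
        (u * (u * v * r)) ^ j     ≈⟨ ^-congˡ j (trans (*-congˡ uvr≈1) (*-identityʳ u)) ⟩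
        u ^ j                     ∎

    square-quotient-root⇒ : ∀ j → (u * u * r) ^ j ≈ 1# → u ^ j ≈ v ^ j
    square-quotient-root⇒ j e = trans (sym (square-quotient j)) (trans (*-congʳ e) (*-identityˡ _))

    square-quotient-root⇐ : ∀ j → u ^ j ≈ v ^ j → (u * u * r) ^ j ≈ 1#
    square-quotient-root⇐ j e = begin
      q ^ j                              ≈⟨ *-identityʳ _ ⟨
      q ^ j * 1#                         ≈⟨ *-congˡ v⁻¹-inverse ⟨
      q ^ j * (v ^ j * (u * r) ^ j)      ≈⟨ *-assoc _ _ _ ⟨
      q ^ j * v ^ j * (u * r) ^ j        ≈⟨ *-congʳ (trans (square-quotient j) e) ⟩
      v ^ j * (u * r) ^ j                ≈⟨ v⁻¹-inverse ⟩
      1#                                 ∎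
      where
      q = u * u * r
      v⁻¹-inverse : v ^ j * (u * r) ^ j ≈ 1#
      v⁻¹-inverse = begin
        v ^ j * (u * r) ^ j   ≈⟨ ^-distrib-* v (u * r) j ⟨
        (v * (u * r)) ^ j     ≈⟨ ^-congˡ j (solve 3 (λ u v r → v :* (u :* r) := u :* v :* r) refl u v r) ⟩
        (u * v * r) ^ j       ≈⟨ ^-congˡ j uvr≈1 ⟩
        1# ^ j                ≈⟨ 1^n≈1 j ⟩
        1#                    ∎

-- Counting in finite sets

element : ∀ {n} (S : Subset n) → Fin ∣ S ∣ → Fin n
element (inside  ∷ S) zero    = zero
element (inside  ∷ S) (suc i) = suc (element S i)
element (outside ∷ S) i       = suc (element S i)

element-∈ : ∀ {n} (S : Subset n) i → element S i Subset.∈ S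
element-∈ (inside  ∷ S) zero    = here
element-∈ (inside  ∷ S) (suc i) = there (element-∈ S i)
element-∈ (outside ∷ S) i       = there (element-∈ S i)

element-injective : ∀ {n} (S : Subset n) {i j} → element S i ≡ element S j → i ≡ j
element-injective (inside  ∷ S) {zero}  {zero}  _ = ≡.refl
element-injective (inside  ∷ S) {suc i} {suc j} e = cong suc (element-injective S (Fin.suc-injective e))
element-injective (outside ∷ S) e = element-injective S (Fin.suc-injective e)

module _ {n} {P : Pred (Fin n) 0ℓ} (P? : Decidable P) where

  subset : Subset n
  subset = tabulate (does ∘ P?)

  ∈-subset⁺ : ∀ {i} → P i → i Subset.∈ subset
  ∈-subset⁺ {i} p = lookup⇒[]= i subset (≡.trans (lookup∘tabulate (does ∘ P?) i) (dec-true (P? i) p))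

  ∈-subset⁻ : ∀ {i} → i Subset.∈ subset → P i
  ∈-subset⁻ {i} i∈ with P? i | ≡.trans (≡.sym (lookup∘tabulate (does ∘ P?) i)) ([]=⇒lookup i∈)
  ... | yes p | _  = p
  ... | no _  | ()

-- Entries sharing a label are told apart by the number of earlier entries with that label.
module _ {n k} (e : Fin n → Fin k) where

  earlier? : ∀ i → Decidable (λ j → j Fin.< i × e j ≡ e i)
  earlier? i j = (j Fin.<? i) ×-dec (e j Fin.≟ e i)

  rank : Fin n → ℕ
  rank i = ∣ subset (earlier? i) ∣

  fibre? : ∀ v → Decidable (λ j → e j ≡ v)
  fibre? v j = e j Fin.≟ v

  fibre : Fin k → Subset n
  fibre v = subset (fibre? v)

  -- Strict because i belongs to its own fibre but is not earlier than itself; hence ranks in a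
  -- fibre of size at most d fit into `Fin d`.
  rank<fibre : ∀ i → rank i ℕ.< ∣ fibre (e i) ∣
  rank<fibre i = Subset.p⊂q⇒∣p∣<∣q∣
    ((λ j∈ → ∈-subset⁺ (fibre? (e i)) (proj₂ (∈-subset⁻ (earlier? i) j∈))) ,
     i , ∈-subset⁺ (fibre? (e i)) ≡.refl ,
     λ i∈ → ℕ.<-irrefl ≡.refl (proj₁ (∈-subset⁻ (earlier? i) i∈)))

  rank-mono-< : ∀ {i j} → i Fin.< j → e i ≡ e j → rank i ℕ.< rank j
  rank-mono-< {i} {j} i<j eᵢ≡eⱼ = Subset.p⊂q⇒∣p∣<∣q∣
    ((λ h∈ → let h<i , eₕ≡eᵢ = ∈-subset⁻ (earlier? i) h∈
             in ∈-subset⁺ (earlier? j) (Fin.<-trans h<i i<j , ≡.trans eₕ≡eᵢ eᵢ≡eⱼ)) ,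
     i , ∈-subset⁺ (earlier? j) (i<j , eᵢ≡eⱼ) ,
     λ i∈ → ℕ.<-irrefl ≡.refl (proj₁ (∈-subset⁻ (earlier? i) i∈)))

  rank-injective : ∀ {i j} → e i ≡ e j → rank i ≡ rank j → i ≡ j
  rank-injective {i} {j} eᵢ≡eⱼ r with Fin.<-cmp i j
  ... | tri< i<j _ _ = contradiction r (ℕ.<⇒≢ (rank-mono-< i<j eᵢ≡eⱼ))
  ... | tri≈ _ i≡j _ = i≡j
  ... | tri> _ _ j<i = contradiction (≡.sym r) (ℕ.<⇒≢ (rank-mono-< j<i (≡.sym eᵢ≡eⱼ)))

least : ∀ {P : ℕ → Set} → (∀ n → Dec (P n)) → ∀ n → P n →
        ∃[ m ] (P m × m ≤ n × (∀ i → P i → m ≤ i))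
least {P} P? n p with search n
  where
  search : ∀ n → (∀ i → i ℕ.< n → ¬ P i) ⊎ ∃[ m ] (P m × m ℕ.< n × (∀ i → P i → m ≤ i))
  search zero    = inj₁ λ _ ()
  search (suc n) with search n | P? n
  ... | inj₂ (m , p , m<n , min) | _     = inj₂ (m , p , ℕ.m<n⇒m<1+n m<n , min)
  ... | inj₁ none                | yes p = inj₂ (n , p , ℕ.n<1+n n , λ i q → ℕ.≮⇒≥ λ i<n → none i i<n q)
  ... | inj₁ none                | no ¬p = inj₁ λ i i≤n q → case i (ℕ.m<1+n⇒m<n∨m≡n i≤n) q
    where
    case : ∀ i → i ℕ.< n ⊎ i ≡ n → ¬ P i
    case i (inj₁ i<n) q = none i i<n q
    case i (inj₂ ≡.refl) q = ¬p q
... | inj₂ (m , q , m<n , min) = m , q , ℕ.<⇒≤ m<n , min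
... | inj₁ none = n , p , ℕ.≤-refl , λ i q → ℕ.≮⇒≥ λ i<n → none i i<n q

-- Multiplicities of roots of unity

module Multiplicities (K : ConstructiveField) where

  open FieldProperties K
  open SetoidReasoning setoid

  Multiplicity≤ : ∀ {n} → ℕ → Vector Carrier n → Set
  Multiplicity≤ {n} h x = ∀ v (S : Subset n) → (∀ i → i Subset.∈ S → x i ≈ v) → ∣ S ∣ ≤ h

  Solution : ℕ → ℕ → ℕ → Set
  Solution n k h = ∃[ y ] ((∀ i → y i ^ k ≈ 1#) × sum {n} y ≈ 0# × Multiplicity≤ h y)

  DistinctSolution : ℕ → ℕ → ℕ → Set
  DistinctSolution n m ℓ =
    ∃[ x ] ((∀ i → x i ^ m ≈ 1#) × sum {n} (λ i → x i ^ ℓ) ≈ 0# × Distinct x)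

  Multiplicity≤-mono : ∀ {n h h′} (x : Vector Carrier n) → h ≤ h′ → Multiplicity≤ h x → Multiplicity≤ h′ x
  Multiplicity≤-mono x h≤h′ mult v S h = ℕ.≤-trans (mult v S h) h≤h′

  Distinct⇒Multiplicity≤1 : ∀ {n} (x : Vector Carrier n) → Distinct x → Multiplicity≤ 1 x
  Distinct⇒Multiplicity≤1 x distinct v S h = ℕ.≮⇒≥ λ 1<∣S∣ →
    let i = fromℕ< {0} (ℕ.<-trans (s≤s z≤n) 1<∣S∣)
        j = fromℕ< 1<∣S∣
    in distinct (element S i) (element S j)
         (λ e → ℕ.0≢1+n (Fin.fromℕ<-injective 0 1 _ _ (element-injective S e)))
         (trans (h _ (element-∈ S i)) (sym (h _ (element-∈ S j))))

  Multiplicity≤1⇒Distinct : ∀ {n} (x : Vector Carrier n) → Multiplicity≤ 1 x → Distinct x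
  Multiplicity≤1⇒Distinct x mult i j i≢j xᵢ≈xⱼ = ℕ.<⇒≱
    (subst (ℕ._< ∣ ⁅ i ⁆ ∪ ⁅ j ⁆ ∣) (Subset.∣⁅x⁆∣≡1 i) (Subset.p⊂q⇒∣p∣<∣q∣
      (Subset.p⊆p∪q ⁅ j ⁆ , j , Subset.x∈p∪q⁺ (inj₂ (Subset.x∈⁅x⁆ j)) ,
       λ j∈⁅i⁆ → i≢j (≡.sym (Subset.x∈⁅y⁆⇒x≡y i j∈⁅i⁆)))))
    (mult (x j) (⁅ i ⁆ ∪ ⁅ j ⁆) λ h h∈ → ≈xⱼ h (Subset.x∈p∪q⁻ ⁅ i ⁆ ⁅ j ⁆ h∈))
    where
    ≈xⱼ : ∀ h → h Subset.∈ ⁅ i ⁆ ⊎ h Subset.∈ ⁅ j ⁆ → x h ≈ x j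
    ≈xⱼ h (inj₁ h∈) rewrite Subset.x∈⁅y⁆⇒x≡y i h∈ = xᵢ≈xⱼ
    ≈xⱼ h (inj₂ h∈) rewrite Subset.x∈⁅y⁆⇒x≡y j h∈ = refl

  -- By Bézout, d ≡ y (l d) modulo k d up to sign, so x^(k d) and x^(l d) determine x^d.
  power-determined : ∀ k l d → Coprime k l → ∀ {a b v} → a ^ (k ℕ.* d) ≈ 1# → b ^ (k ℕ.* d) ≈ 1# →
                     a ^ (l ℕ.* d) ≈ v → b ^ (l ℕ.* d) ≈ v → a ^ d ≈ b ^ d
  power-determined k l d k⊥l {a} {b} {v} aᵐ≈1 bᵐ≈1 aˡ≈v bˡ≈v with coprime-Bézout k⊥l
  -- Here 1 + x k = y l, so a^d = v^y for every admissible a.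
  ... | Bézout.-+ x y eq = trans (power aᵐ≈1 aˡ≈v) (sym (power bᵐ≈1 bˡ≈v))
    where
    power : ∀ {a} → a ^ (k ℕ.* d) ≈ 1# → a ^ (l ℕ.* d) ≈ v → a ^ d ≈ v ^ y
    power {a} aᵐ≈1 aˡ≈v = begin
      a ^ d                              ≈⟨ *-identityʳ _ ⟨
      a ^ d * 1#                         ≈⟨ *-congˡ (^-multiple (k ℕ.* d) aᵐ≈1 x) ⟨
      a ^ d * a ^ (x ℕ.* (k ℕ.* d))      ≈⟨ ^-homo-* a d _ ⟨
      a ^ (d ℕ.+ x ℕ.* (k ℕ.* d))        ≈⟨ ^-congʳ a (≡.trans (assoc₁ d x k)
                                              (≡.trans (cong (ℕ._* d) eq) (assoc₂ d y l))) ⟩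
      a ^ (l ℕ.* d ℕ.* y)                ≈⟨ ^-assocʳ a (l ℕ.* d) y ⟨
      (a ^ (l ℕ.* d)) ^ y                ≈⟨ ^-congˡ y aˡ≈v ⟩
      v ^ y                              ∎
      where
      assoc₁ : ∀ d x k → d ℕ.+ x ℕ.* (k ℕ.* d) ≡ (1 ℕ.+ x ℕ.* k) ℕ.* d
      assoc₁ = ℕSolver.solve-∀
      assoc₂ : ∀ d y l → y ℕ.* l ℕ.* d ≡ l ℕ.* d ℕ.* y
      assoc₂ = ℕSolver.solve-∀
  -- Here 1 + y l = x k, so a^d and b^d are both inverse to v^y, and inverses are unique.
  ... | Bézout.+- x y eq = begin
      a ^ d                        ≈⟨ *-identityʳ _ ⟨
      a ^ d * 1#                   ≈⟨ *-congˡ (inverse bᵐ≈1 bˡ≈v) ⟨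
      a ^ d * (b ^ d * v ^ y)      ≈⟨ *-assoc _ _ _ ⟨
      a ^ d * b ^ d * v ^ y        ≈⟨ *-congʳ (*-comm _ _) ⟩
      b ^ d * a ^ d * v ^ y        ≈⟨ *-assoc _ _ _ ⟩
      b ^ d * (a ^ d * v ^ y)      ≈⟨ *-congˡ (inverse aᵐ≈1 aˡ≈v) ⟩
      b ^ d * 1#                   ≈⟨ *-identityʳ _ ⟩
      b ^ d                        ∎
    where
    inverse : ∀ {a} → a ^ (k ℕ.* d) ≈ 1# → a ^ (l ℕ.* d) ≈ v → a ^ d * v ^ y ≈ 1#
    inverse {a} aᵐ≈1 aˡ≈v = begin
      a ^ d * v ^ y                      ≈⟨ *-congˡ (^-congˡ y aˡ≈v) ⟨
      a ^ d * (a ^ (l ℕ.* d)) ^ y        ≈⟨ *-congˡ (^-assocʳ a (l ℕ.* d) y) ⟩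
      a ^ d * a ^ (l ℕ.* d ℕ.* y)        ≈⟨ ^-homo-* a d _ ⟨
      a ^ (d ℕ.+ l ℕ.* d ℕ.* y)          ≈⟨ ^-congʳ a (≡.trans (assoc₁ d y l)
                                              (≡.trans (cong (ℕ._* d) eq) (ℕ.*-assoc x k d))) ⟩
      a ^ (x ℕ.* (k ℕ.* d))              ≈⟨ ^-multiple (k ℕ.* d) aᵐ≈1 x ⟩
      1#                                 ∎
      where
      assoc₁ : ∀ d y l → d ℕ.+ l ℕ.* d ℕ.* y ≡ (1 ℕ.+ y ℕ.* l) ℕ.* d
      assoc₁ = ℕSolver.solve-∀

  power-root : ∀ k l d {a} → a ^ (k ℕ.* d) ≈ 1# → (a ^ (l ℕ.* d)) ^ k ≈ 1#
  power-root k l d {a} aᵐ≈1 = begin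
    (a ^ (l ℕ.* d)) ^ k        ≈⟨ ^-assocʳ a (l ℕ.* d) k ⟩
    a ^ (l ℕ.* d ℕ.* k)        ≈⟨ ^-congʳ a (assoc l d k) ⟩
    a ^ (l ℕ.* (k ℕ.* d))      ≈⟨ ^-multiple (k ℕ.* d) aᵐ≈1 l ⟩
    1#                         ∎
    where
    assoc : ∀ l d k → l ℕ.* d ℕ.* k ≡ l ℕ.* (k ℕ.* d)
    assoc = ℕSolver.solve-∀

  -- d + 1 distinct x_i with equal x_i^(l d) would be roots of one polynomial X^d - c.
  powers-Multiplicity≤ : ∀ {n} k l d .{{_ : NonZero d}} → Coprime k l → {x : Vector Carrier n} →
                         (∀ i → x i ^ (k ℕ.* d) ≈ 1#) → Distinct x →
                         Multiplicity≤ d (λ i → x i ^ (l ℕ.* d))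
  powers-Multiplicity≤ k l d k⊥l {x} root distinct v S h = ℕ.≮⇒≥ λ d<∣S∣ →
    let f = λ i → element S (inject≤ i d<∣S∣)
    in ^-roots d (x (f zero) ^ d) (x ∘ f)
         (λ i j i≢j → distinct (f i) (f j)
           (i≢j ∘ Fin.inject≤-injective d<∣S∣ d<∣S∣ i j ∘ element-injective S))
         (λ i → power-determined k l d k⊥l (root (f i)) (root (f zero))
           (h (f i) (element-∈ S _)) (h (f zero) (element-∈ S _)))

  distinct⇒bounded : ∀ n k l d .{{_ : NonZero d}} → Coprime k l →
                     DistinctSolution n (k ℕ.* d) (l ℕ.* d) → Solution n k d
  distinct⇒bounded n k l d k⊥l (x , root , vanish , distinct) =
    (λ i → x i ^ (l ℕ.* d)) , (λ i → power-root k l d (root i)) , vanish ,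
    powers-Multiplicity≤ k l d k⊥l root distinct

  -- The d preimages of θ^e under x ↦ x^(l d) are ω^(k t + e), t < d, where θ = ω^(l d).
  bounded⇒distinct : ∀ n k l d .{{_ : NonZero k}} .{{_ : NonZero d}} → Coprime k l →
                     ∃[ ω ] Primitive (k ℕ.* d) ω →
                     Solution n k d → DistinctSolution n (k ℕ.* d) (l ℕ.* d)
  bounded⇒distinct n k l d k⊥l (ω , ω-primitive) (y , root , vanish , mult) =
    x , (λ i → root-^ (k ℕ.* d) (proj₁ ω-primitive) (toℕ (E i))) ,
    trans (sum-cong-≋ xˡ≈y) vanish , distinct
    where
    θ : Carrier
    θ = ω ^ (l ℕ.* d)
    generated : ∀ i → ∃[ e ] y i ≈ θ ^ toℕ {k} e
    generated i = Primitive-generates (Primitive-power k l d k⊥l ω-primitive) (root i)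
    e : Fin n → Fin k
    e i = proj₁ (generated i)
    fibre≤d : ∀ i → ∣ fibre e (e i) ∣ ≤ d
    fibre≤d i = mult (θ ^ toℕ (e i)) (fibre e (e i)) λ j j∈ →
      trans (proj₂ (generated j)) (^-congʳ θ (cong toℕ (∈-subset⁻ (fibre? e (e i)) j∈)))
    -- The rank `t i` separates positions with equal `y i`. The value of `combine (t i) (e i)` is k
    -- t + e, which stays below k d, the order of ω, so distinct pairs give distinct powers.
    t : Fin n → Fin d
    t i = fromℕ< (ℕ.<-≤-trans (rank<fibre e i) (fibre≤d i))
    E : Fin n → Fin (d ℕ.* k)
    E i = combine (t i) (e i)
    x : Vector Carrier n
    x i = ω ^ toℕ (E i)
    distinct : Distinct x
    distinct i j i≢j xᵢ≈xⱼ = i≢j (rank-injective e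
      (Fin.combine-injectiveʳ (t i) (e i) (t j) (e j) Eᵢ≡Eⱼ)
      (Fin.fromℕ<-injective _ _ _ _ (Fin.combine-injectiveˡ (t i) (e i) (t j) (e j) Eᵢ≡Eⱼ)))
      where
      E<m : ∀ i → toℕ (E i) ℕ.< k ℕ.* d
      E<m i = subst (toℕ (E i) ℕ.<_) (ℕ.*-comm d k) (Fin.toℕ<n (E i))
      Eᵢ≡Eⱼ : E i ≡ E j
      Eᵢ≡Eⱼ = Fin.toℕ-injective (Primitive-injective ω-primitive (E<m i) (E<m j) xᵢ≈xⱼ)
    xˡ≈y : ∀ i → x i ^ (l ℕ.* d) ≈ y i
    xˡ≈y i = begin
      (ω ^ toℕ (E i)) ^ (l ℕ.* d)
        ≈⟨ ^-assocʳ ω (toℕ (E i)) (l ℕ.* d) ⟩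
      ω ^ (toℕ (E i) ℕ.* (l ℕ.* d))
        ≈⟨ ^-congʳ ω (≡.trans (cong (ℕ._* (l ℕ.* d)) (Fin.toℕ-combine (t i) (e i)))
             (expand k l d (toℕ (t i)) (toℕ (e i)))) ⟩
      ω ^ ((toℕ (t i) ℕ.* l) ℕ.* (k ℕ.* d) ℕ.+ l ℕ.* d ℕ.* toℕ (e i))
        ≈⟨ ^-homo-* ω ((toℕ (t i) ℕ.* l) ℕ.* (k ℕ.* d)) _ ⟩
      ω ^ ((toℕ (t i) ℕ.* l) ℕ.* (k ℕ.* d)) * ω ^ (l ℕ.* d ℕ.* toℕ (e i))
        ≈⟨ *-congʳ (^-multiple (k ℕ.* d) (proj₁ ω-primitive) (toℕ (t i) ℕ.* l)) ⟩
      1# * ω ^ (l ℕ.* d ℕ.* toℕ (e i))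
        ≈⟨ *-identityˡ _ ⟩
      ω ^ (l ℕ.* d ℕ.* toℕ (e i))
        ≈⟨ ^-assocʳ ω (l ℕ.* d) (toℕ (e i)) ⟨
      θ ^ toℕ (e i)
        ≈⟨ proj₂ (generated i) ⟨
      y i ∎
      where
      expand : ∀ k l d t e → (k ℕ.* t ℕ.+ e) ℕ.* (l ℕ.* d) ≡ (t ℕ.* l) ℕ.* (k ℕ.* d) ℕ.+ l ℕ.* d ℕ.* e
      expand = ℕSolver.solve-∀

  -- Every k-th root of unity is a power of θ, so up to `≈` the candidates are the k^n exponent
  -- maps. Equal powers have equal exponents, which turns multiplicities into sizes of fibres.
  Solution-dec : ∀ n k h .{{_ : NonZero k}} → ∃[ θ ] Primitive k θ → Dec (Solution n k h)
  Solution-dec n k h (θ , θ-primitive) = Dec.map′ from-code to-code (Fin.any? code?)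
    where
    powersOf : (Fin n → Fin k) → Vector Carrier n
    powersOf e i = θ ^ toℕ (e i)
    Good : (Fin n → Fin k) → Set
    Good e = sum (powersOf e) ≈ 0# × (∀ v → ∣ fibre e v ∣ ≤ h)
    good? : Decidable Good
    good? e = sum-powers-dec (proj₁ θ-primitive) (toℕ ∘ e) ×-dec Fin.all? (λ v → ∣ fibre e v ∣ ℕ.≤? h)
    code? : Decidable (λ (c : Fin (k ℕ.^ n)) → Good (finToFun c))
    code? c = good? (finToFun c)
    from-code : ∃[ c ] Good (finToFun c) → Solution n k h
    from-code (c , vanish , bound) = powersOf e , (λ i → root-^ k (proj₁ θ-primitive) (toℕ (e i))) ,
      vanish , mult
      where
      e : Fin n → Fin k
      e = finToFun c
      mult : Multiplicity≤ h (powersOf e)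
      -- The value `v` is an arbitrary complex number; only a position in `S` supplies an exponent
      -- whose fibre contains `S`.
      mult v S eq with Subset.nonempty? S
      ... | no empty = subst (_≤ h)
              (≡.sym (≡.trans (cong ∣_∣ (Subset.Empty-unique empty)) (Subset.∣⊥∣≡0 n))) z≤n
      ... | yes (i , i∈S) = ℕ.≤-trans (Subset.p⊆q⇒∣p∣≤∣q∣ λ {j} j∈S → ∈-subset⁺ (fibre? e (e i))
              (Fin.toℕ-injective (Primitive-injective θ-primitive (Fin.toℕ<n (e j)) (Fin.toℕ<n (e i))
                (trans (eq j j∈S) (sym (eq i i∈S)))))) (bound (e i))
    to-code : Solution n k h → ∃[ c ] Good (finToFun c)
    to-code (y , root , vanish , mult) = funToFin e , good
      where
      generated : ∀ i → ∃[ e ] y i ≈ θ ^ toℕ {k} e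
      generated i = Primitive-generates θ-primitive (root i)
      e : Fin n → Fin k
      e i = proj₁ (generated i)
      -- Decoding the code of `e` returns `e` only pointwise, so the decoded map is treated as a map
      -- of its own.
      e′ : Fin n → Fin k
      e′ = finToFun (funToFin e)
      y≈ : ∀ i → y i ≈ powersOf e′ i
      y≈ i = trans (proj₂ (generated i)) (^-congʳ θ (cong toℕ (≡.sym (Fin.finToFun-funToFin e i))))
      good : Good e′
      good = trans (sum-cong-≋ (λ i → sym (y≈ i))) vanish ,
        λ v → mult (θ ^ toℕ v) (fibre e′ v) λ i i∈ →
          trans (y≈ i) (^-congʳ θ (cong toℕ (∈-subset⁻ (fibre? e′ v) i∈)))

  least-bound : ∀ n k d .{{_ : NonZero k}} .{{_ : NonZero d}} → ∃[ θ ] Primitive k θ → Solution n k d →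
                ∃[ h ] (0 ℕ.< h × h ≤ d × Solution n k h × (∀ h′ → 0 ℕ.< h′ → Solution n k h′ → h ≤ h′))
  least-bound n k d θ sol =
    let h , (0<h , solₕ) , h≤d , minimal = least (λ h → (0 ℕ.<? h) ×-dec Solution-dec n k h θ) d
          (ℕ.>-nonZero⁻¹ d , sol)
    in h , 0<h , h≤d , solₕ , λ h′ 0<h′ sol′ → minimal h′ (0<h′ , sol′)

-- Real and complex numbers

open import Defs
open import Relation.Binary.PropositionalEquality using (refl; sym; trans)
open +-*-Solver using (solve; _:=_; _:+_; _:*_; _:-_; :-_; con)
open RawMonoid ℚ.+-0-rawMonoid using () renaming (_×_ to _·_)

½*-pos : ∀ {ε} → 0ℚ ℚ.< ε → 0ℚ ℚ.< ½ ℚ.* ε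
½*-pos {ε} ε>0 = subst (ℚ._< ½ ℚ.* ε) (ℚ.*-zeroʳ ½) (ℚ.*-monoʳ-<-pos ½ ε>0)

½*+½* : ∀ ε → ½ ℚ.* ε ℚ.+ ½ ℚ.* ε ≡ ε
½*+½* ε = trans (sym (ℚ.*-distribʳ-+ ε ½ ½)) (ℚ.*-identityˡ ε)

*-pos : ∀ {p q} → 0ℚ ℚ.< p → 0ℚ ℚ.< q → 0ℚ ℚ.< p ℚ.* q
*-pos {p} p>0 q>0 = subst (ℚ._< p ℚ.* _) (ℚ.*-zeroʳ p) (ℚ.*-monoʳ-<-pos p {{ℚ.positive p>0}} q>0)

*-nonNeg : ∀ {p q} → 0ℚ ℚ.≤ p → 0ℚ ℚ.≤ q → 0ℚ ℚ.≤ p ℚ.* q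
*-nonNeg {p} p≥0 q≥0 =
  subst (ℚ._≤ p ℚ.* _) (ℚ.*-zeroʳ p) (ℚ.*-monoˡ-≤-nonNeg p {{ℚ.nonNegative p≥0}} q≥0)

*-mono-≤ : ∀ {p q r s} → 0ℚ ℚ.≤ r → 0ℚ ℚ.≤ q → p ℚ.≤ q → r ℚ.≤ s → p ℚ.* r ℚ.≤ q ℚ.* s
*-mono-≤ {q = q} {r} r≥0 q≥0 p≤q r≤s = ℚ.≤-trans
  (ℚ.*-monoʳ-≤-nonNeg r {{ℚ.nonNegative r≥0}} p≤q)
  (ℚ.*-monoˡ-≤-nonNeg q {{ℚ.nonNegative q≥0}} r≤s)

p≤∣p∣ : ∀ p → p ℚ.≤ ℚ.∣ p ∣
p≤∣p∣ p with ℚ.≤-total 0ℚ p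
... | inj₁ 0≤p = ℚ.≤-reflexive (sym (ℚ.0≤p⇒∣p∣≡p 0≤p))
... | inj₂ p≤0 = ℚ.≤-trans p≤0 (ℚ.0≤∣p∣ p)

∣∣²≡² : ∀ p → ℚ.∣ p ∣ ℚ.* ℚ.∣ p ∣ ≡ p ℚ.* p
∣∣²≡² p with ℚ.∣p∣≡p∨∣p∣≡-p p
... | inj₁ e = cong₂ ℚ._*_ e e
... | inj₂ e = trans (cong₂ ℚ._*_ e e) (solve 1 (λ a → :- a :* :- a := a :* a) refl p)

square-nonNeg : ∀ p → 0ℚ ℚ.≤ p ℚ.* p
square-nonNeg p = subst (0ℚ ℚ.≤_) (∣∣²≡² p) (*-nonNeg (ℚ.0≤∣p∣ p) (ℚ.0≤∣p∣ p))

square-cancel-≤ : ∀ {p q} → 0ℚ ℚ.≤ q → p ℚ.* p ℚ.≤ q ℚ.* q → p ℚ.≤ q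
square-cancel-≤ {p} {q} q≥0 p²≤q² with p ℚ.≤? q
... | yes p≤q = p≤q
... | no p≰q = contradiction (ℚ.≤-<-trans
        (ℚ.≤-trans p²≤q² (ℚ.*-monoˡ-≤-nonNeg q {{ℚ.nonNegative q≥0}} (ℚ.<⇒≤ q<p)))
        (ℚ.*-monoˡ-<-pos p {{ℚ.positive (ℚ.≤-<-trans q≥0 q<p)}} q<p)) (ℚ.<-irrefl refl)
  where q<p = ℚ.≰⇒> p≰q

-- Eventual properties and null sequences

Eventually-∧ : ∀ {P Q R : ℕ → Set} → (∀ {i} → P i → Q i → R i) →
               Eventually P → Eventually Q → Eventually R
Eventually-∧ f (M , p) (N , q) = M ℕ.⊔ N , λ i h →
  f (p i (ℕ.m⊔n≤o⇒m≤o M N h)) (q i (ℕ.m⊔n≤o⇒n≤o M N h))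

Eventually-map : ∀ {P Q : ℕ → Set} → (∀ {i} → P i → Q i) → Eventually P → Eventually Q
Eventually-map f (N , p) = N , λ i h → f (p i h)

Eventually-∃ : ∀ {P} → Eventually P → ∃[ i ] P i
Eventually-∃ (N , p) = N , p N ℕ.≤-refl

-- `x ≈ᴿ y` unfolds to `Null` of the termwise difference, so the laws of `≈ᴿ` become closure
-- properties of null sequences.
Null : (ℕ → ℚ) → Set
Null f = ∀ ε → 0ℚ ℚ.< ε → Eventually (λ i → ℚ.∣ f i ∣ ℚ.< ε)

Null-ext : ∀ {f g} → (∀ i → f i ≡ g i) → Null f → Null g
Null-ext e nf ε ε>0 = Eventually-map (λ {i} → subst (λ p → ℚ.∣ p ∣ ℚ.< ε) (e i)) (nf ε ε>0)

Null-0 : Null (λ _ → 0ℚ)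
Null-0 ε ε>0 = 0 , λ _ _ → ε>0

Null-+ : ∀ {f g} → Null f → Null g → Null (λ i → f i ℚ.+ g i)
Null-+ {f} {g} nf ng ε ε>0 = Eventually-∧
  (λ {i} p q → ℚ.≤-<-trans (ℚ.∣p+q∣≤∣p∣+∣q∣ (f i) (g i))
    (subst (ℚ.∣ f i ∣ ℚ.+ ℚ.∣ g i ∣ ℚ.<_) (½*+½* ε) (ℚ.+-mono-< p q)))
  (nf _ (½*-pos ε>0)) (ng _ (½*-pos ε>0))

Null-neg : ∀ {f} → Null f → Null (λ i → ℚ.- f i)
Null-neg {f} nf ε ε>0 = Eventually-map
  (λ {i} → subst (ℚ._< ε) (sym (ℚ.∣-p∣≡∣p∣ (f i)))) (nf ε ε>0)

Null-* : ∀ {f} x → Null f → Null (λ i → f i ℚ.* seq x i)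
Null-* {f} x nf ε ε>0 with bounded (seq x) (isCauchy x)
... | K , K>0 , x<K = Eventually-∧ (λ {i} → bound i) (nf (ε ℚ.* 1/K) (*-pos ε>0 1/K>0)) x<K
  where
  instance
    K-positive : ℚ.Positive K
    K-positive = ℚ.positive K>0
  K-nonZero : ℚ.NonZero K
  K-nonZero = ℚ.pos⇒nonZero K
  1/K : ℚ
  1/K = ℚ.1/_ K {{K-nonZero}}
  1/K>0 : 0ℚ ℚ.< 1/K
  1/K>0 = ℚ.positive⁻¹ 1/K {{ℚ.1/pos⇒pos K}}
  open ℚ.≤-Reasoning
  bound : ∀ i → ℚ.∣ f i ∣ ℚ.< ε ℚ.* 1/K → ℚ.∣ seq x i ∣ ℚ.< K → ℚ.∣ f i ℚ.* seq x i ∣ ℚ.< ε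
  bound i p q = begin-strict
    ℚ.∣ f i ℚ.* seq x i ∣        ≡⟨ ℚ.∣p*q∣≡∣p∣*∣q∣ (f i) (seq x i) ⟩
    ℚ.∣ f i ∣ ℚ.* ℚ.∣ seq x i ∣  ≤⟨ ℚ.*-monoˡ-≤-nonNeg ℚ.∣ f i ∣ {{ℚ.∣-∣-nonNeg (f i)}} (ℚ.<⇒≤ q) ⟩
    ℚ.∣ f i ∣ ℚ.* K              <⟨ ℚ.*-monoˡ-<-pos K p ⟩
    ε ℚ.* 1/K ℚ.* K              ≡⟨ ℚ.*-assoc ε 1/K K ⟩
    ε ℚ.* (1/K ℚ.* K)            ≡⟨ cong (ε ℚ.*_) (ℚ.*-inverseˡ K {{K-nonZero}}) ⟩
    ε ℚ.* 1ℚ                     ≡⟨ ℚ.*-identityʳ ε ⟩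
    ε                            ∎

p-0≡p : ∀ p → p ℚ.- 0ℚ ≡ p
p-0≡p p = ℚ.+-identityʳ p

≈0⇒Null : ∀ {x} → x ≈ᴿ ℚ→ℝ 0ℚ → Null (seq x)
≈0⇒Null = Null-ext (λ i → p-0≡p _)

Null⇒≈0 : ∀ {x} → Null (seq x) → x ≈ᴿ ℚ→ℝ 0ℚ
Null⇒≈0 = Null-ext (λ i → sym (p-0≡p _))

≗⇒≈ᴿ : ∀ {x y} → (∀ i → seq x i ≡ seq y i) → x ≈ᴿ y
≗⇒≈ᴿ {x} {y} e = Null-ext
  (λ i → sym (trans (cong (ℚ._- seq y i) (e i)) (ℚ.+-inverseʳ (seq y i)))) Null-0

≈ᴿ-sym : ∀ {x y} → x ≈ᴿ y → y ≈ᴿ x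
≈ᴿ-sym {x} {y} e = Null-ext
  (λ i → solve 2 (λ a b → :- (a :- b) := b :- a) refl (seq x i) (seq y i)) (Null-neg e)

≈ᴿ-trans : ∀ {x y z} → x ≈ᴿ y → y ≈ᴿ z → x ≈ᴿ z
≈ᴿ-trans {x} {y} {z} e f = Null-ext
  (λ i → solve 3 (λ a b c → (a :- b) :+ (b :- c) := a :- c) refl (seq x i) (seq y i) (seq z i))
  (Null-+ e f)

+ᴿ-cong : ∀ {x x′ y y′} → x ≈ᴿ x′ → y ≈ᴿ y′ → x +ᴿ y ≈ᴿ x′ +ᴿ y′
+ᴿ-cong {x} {x′} {y} {y′} e f = Null-ext
  (λ i → solve 4 (λ a a′ b b′ → (a :- a′) :+ (b :- b′) := (a :+ b) :- (a′ :+ b′)) refl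
    (seq x i) (seq x′ i) (seq y i) (seq y′ i))
  (Null-+ e f)

-ᴿ-cong : ∀ {x y} → x ≈ᴿ y → -ᴿ x ≈ᴿ -ᴿ y
-ᴿ-cong {x} {y} e = Null-ext
  (λ i → solve 2 (λ a b → :- (a :- b) := :- a :- :- b) refl (seq x i) (seq y i)) (Null-neg e)

*ᴿ-cong : ∀ {x x′ y y′} → x ≈ᴿ x′ → y ≈ᴿ y′ → x *ᴿ y ≈ᴿ x′ *ᴿ y′
*ᴿ-cong {x} {x′} {y} {y′} e f = Null-ext
  (λ i → solve 4 (λ a a′ b b′ → (a :- a′) :* b :+ (b :- b′) :* a′ := a :* b :- a′ :* b′) refl
    (seq x i) (seq x′ i) (seq y i) (seq y′ i))
  (Null-+ (Null-* y e) (Null-* x′ f))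

BoundedAway : (ℕ → ℚ) → Set
BoundedAway f = ∃[ δ ] (0ℚ ℚ.< δ × Eventually (λ i → δ ℚ.≤ ℚ.∣ f i ∣))

BoundedAway⇒¬Null : ∀ {f} → BoundedAway f → ¬ Null f
BoundedAway⇒¬Null (δ , δ>0 , away) null =
  let _ , p = Eventually-∃ (Eventually-∧ ℚ.≤-<-trans away (null δ δ>0)) in ℚ.<-irrefl refl p

-- Past a Cauchy index for ε/4 a single rational term decides: if it is below ε/2, the tail stays
-- below 3ε/4; otherwise the tail stays at or above ε/4.
small⊎away : ∀ x {ε} → 0ℚ ℚ.< ε →
             Eventually (λ i → ℚ.∣ seq x i ∣ ℚ.< ε) ⊎ BoundedAway (seq x)
small⊎away x {ε} ε>0
  with isCauchy x (½ ℚ.* (½ ℚ.* ε)) (½*-pos (½*-pos ε>0))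
... | N , near with ℚ.∣ seq x N ∣ ℚ.<? ½ ℚ.* ε
... | yes small = inj₁ (N , λ i N≤i → begin-strict
        ℚ.∣ seq x i ∣                                      ≡⟨ cong ℚ.∣_∣ (split (seq x i) (seq x N)) ⟩
        ℚ.∣ (seq x i ℚ.- seq x N) ℚ.+ seq x N ∣            ≤⟨ ℚ.∣p+q∣≤∣p∣+∣q∣ (seq x i ℚ.- seq x N) (seq x N) ⟩
        ℚ.∣ seq x i ℚ.- seq x N ∣ ℚ.+ ℚ.∣ seq x N ∣        <⟨ ℚ.+-mono-< (near i N N≤i ℕ.≤-refl) small ⟩
        h′ ℚ.+ h                                           <⟨ ℚ.+-monoˡ-< h h′<h ⟩
        h ℚ.+ h                                            ≡⟨ ½*+½* ε ⟩
        ε                                                  ∎)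
  where
  open ℚ.≤-Reasoning
  h = ½ ℚ.* ε
  h′ = ½ ℚ.* h
  h′<h : h′ ℚ.< h
  h′<h = subst₂ ℚ._<_ (ℚ.+-identityʳ h′) (½*+½* h) (ℚ.+-monoʳ-< h′ (½*-pos (½*-pos ε>0)))
  split : ∀ a b → a ≡ (a ℚ.- b) ℚ.+ b
  split = solve 2 (λ a b → a := (a :- b) :+ b) refl
... | no large = inj₂ (½ ℚ.* h , ½*-pos (½*-pos ε>0) , N , λ i N≤i → ℚ.≮⇒≥ λ p →
        ℚ.<-irrefl refl (begin-strict
        h                                                  ≤⟨ ℚ.≮⇒≥ large ⟩
        ℚ.∣ seq x N ∣                                      ≡⟨ cong ℚ.∣_∣ (split (seq x N) (seq x i)) ⟩
        ℚ.∣ (seq x N ℚ.- seq x i) ℚ.+ seq x i ∣            ≤⟨ ℚ.∣p+q∣≤∣p∣+∣q∣ (seq x N ℚ.- seq x i) (seq x i) ⟩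
        ℚ.∣ seq x N ℚ.- seq x i ∣ ℚ.+ ℚ.∣ seq x i ∣        <⟨ ℚ.+-mono-< (near N i ℕ.≤-refl N≤i) p ⟩
        ½ ℚ.* h ℚ.+ ½ ℚ.* h                                ≡⟨ ½*+½* h ⟩
        h                                                  ∎))
  where
  open ℚ.≤-Reasoning
  h = ½ ℚ.* ε
  split : ∀ a b → a ≡ (a ℚ.- b) ℚ.+ b
  split = solve 2 (λ a b → a := (a :- b) :+ b) refl

Null-stable : ∀ x → ¬ ¬ Null (seq x) → Null (seq x)
Null-stable x ¬¬null ε ε>0 with small⊎away x ε>0
... | inj₁ small = small
... | inj₂ away  = contradiction (BoundedAway⇒¬Null away) ¬¬null

-- Fix ε. If y stayed at distance at least δ from zero, |x y| < η δ would force |x| < η for every η,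
-- making x null after all.
Null-cancel : ∀ x y → Null (λ i → seq x i ℚ.* seq y i) → ¬ Null (seq x) → Null (seq y)
Null-cancel x y xy ¬x ε ε>0 with small⊎away y ε>0
... | inj₁ small = small
... | inj₂ (δ , δ>0 , away) = contradiction x-null ¬x
  where
  x-null : Null (seq x)
  x-null η η>0 = Eventually-∧
    (λ {i} p q → ℚ.≰⇒> λ η≤x → ℚ.<-irrefl refl (ℚ.<-≤-trans q
      (subst (η ℚ.* δ ℚ.≤_) (sym (ℚ.∣p*q∣≡∣p∣*∣q∣ (seq x i) (seq y i)))
        (*-mono-≤ (ℚ.<⇒≤ δ>0) (ℚ.0≤∣p∣ (seq x i)) η≤x p))))
    away (xy (η ℚ.* δ) (*-pos η>0 δ>0))

Null-square⇒Null : ∀ {f} → Null (λ i → f i ℚ.* f i) → Null f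
Null-square⇒Null {f} sq ε ε>0 = Eventually-map
  (λ {i} p → ℚ.≰⇒> λ ε≤f → ℚ.<-irrefl refl (ℚ.<-≤-trans p
    (subst (ε ℚ.* ε ℚ.≤_) (sym (ℚ.∣p*q∣≡∣p∣*∣q∣ (f i) (f i)))
      (*-mono-≤ (ℚ.<⇒≤ ε>0) (ℚ.0≤∣p∣ (f i)) ε≤f ε≤f))))
  (sq (ε ℚ.* ε) (*-pos ε>0 ε>0))

Null-squeeze : ∀ {f g} → (∀ i → 0ℚ ℚ.≤ f i) → (∀ i → f i ℚ.≤ g i) → Null g → Null f
Null-squeeze 0≤f f≤g ng ε ε>0 = Eventually-map
  (λ {i} p → subst (ℚ._< ε) (sym (ℚ.0≤p⇒∣p∣≡p (0≤f i)))
    (ℚ.≤-<-trans (f≤g i) (subst (ℚ._< ε) (ℚ.0≤p⇒∣p∣≡p (ℚ.≤-trans (0≤f i) (f≤g i))) p)))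
  (ng ε ε>0)

Null-sum-squares : ∀ {f g} → Null (λ i → f i ℚ.* f i ℚ.+ g i ℚ.* g i) → Null f × Null g
Null-sum-squares {f} {g} n =
  Null-square⇒Null (Null-squeeze (λ i → square-nonNeg (f i))
    (λ i → subst (ℚ._≤ f i ℚ.* f i ℚ.+ g i ℚ.* g i) (ℚ.+-identityʳ (f i ℚ.* f i))
      (ℚ.+-monoʳ-≤ (f i ℚ.* f i) (square-nonNeg (g i)))) n) ,
  Null-square⇒Null (Null-squeeze (λ i → square-nonNeg (g i))
    (λ i → subst (ℚ._≤ f i ℚ.* f i ℚ.+ g i ℚ.* g i) (ℚ.+-identityˡ (g i ℚ.* g i))
      (ℚ.+-monoˡ-≤ (g i ℚ.* g i) (square-nonNeg (f i)))) n)

Null-local : ∀ x y → Null (λ i → (seq x i ℚ.+ seq y i) ℚ.- 1ℚ) → ¬ Null (seq x) ⊎ ¬ Null (seq y)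
Null-local x y near with small⊎away x {½ ℚ.* ½} (½*-pos (ℚ.positive⁻¹ ½))
... | inj₂ away = inj₁ (BoundedAway⇒¬Null away)
-- Were y null as well, some index would give 1 ≤ |x| + |y| + |x + y - 1| < ¼ + ¼ + ½.
... | inj₁ x<¼ = inj₂ λ y-null →
      let i , (p , q) , r = Eventually-∃ (Eventually-∧ _,_
            (Eventually-∧ _,_ x<¼ (y-null (½ ℚ.* ½) (½*-pos (ℚ.positive⁻¹ ½))))
            (near ½ (ℚ.positive⁻¹ ½)))
      in ℚ.<-irrefl refl (begin-strict
        1ℚ
          ≡⟨ solve 2 (λ a b → con 1ℚ := (a :+ b) :+ :- ((a :+ b) :- con 1ℚ)) refl (seq x i) (seq y i) ⟩
        (seq x i ℚ.+ seq y i) ℚ.- ((seq x i ℚ.+ seq y i) ℚ.- 1ℚ)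
          ≤⟨ p≤∣p∣ _ ⟩
        ℚ.∣ (seq x i ℚ.+ seq y i) ℚ.- ((seq x i ℚ.+ seq y i) ℚ.- 1ℚ) ∣
          ≤⟨ ℚ.∣p-q∣≤∣p∣+∣q∣ (seq x i ℚ.+ seq y i) _ ⟩
        ℚ.∣ seq x i ℚ.+ seq y i ∣ ℚ.+ ℚ.∣ (seq x i ℚ.+ seq y i) ℚ.- 1ℚ ∣
          ≤⟨ ℚ.+-monoˡ-≤ _ (ℚ.∣p+q∣≤∣p∣+∣q∣ (seq x i) (seq y i)) ⟩
        (ℚ.∣ seq x i ∣ ℚ.+ ℚ.∣ seq y i ∣) ℚ.+ ℚ.∣ (seq x i ℚ.+ seq y i) ℚ.- 1ℚ ∣
          <⟨ ℚ.+-mono-< (ℚ.+-mono-< p q) r ⟩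
        (½ ℚ.* ½ ℚ.+ ½ ℚ.* ½) ℚ.+ ½
          ≡⟨⟩
        1ℚ ∎)
  where
  open ℚ.≤-Reasoning

-- Ring structure and field axioms of ℂ

≗⇒≈ : ∀ {z w} → (∀ i → seq (re z) i ≡ seq (re w) i) → (∀ i → seq (im z) i ≡ seq (im w) i) → z ≈ w
≗⇒≈ {z} {w} p q = ≗⇒≈ᴿ {re z} {re w} p , ≗⇒≈ᴿ {im z} {im w} q

ℂ-commutativeRing : CommutativeRing 0ℓ 0ℓ
ℂ-commutativeRing = record
  { Carrier = ℂ ; _≈_ = _≈_ ; _+_ = _+ᶜ_ ; _*_ = _*ᶜ_ ; -_ = -ᶜ_ ; 0# = 0ᶜ ; 1# = 1ᶜ
  ; isCommutativeRing = record
    { isRing = record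
      { +-isAbelianGroup = record
        { isGroup = record
          { isMonoid = record
            { isSemigroup = record
              { isMagma = record
                { isEquivalence = record
                  { refl = λ {z} → ≗⇒≈ {z} {z} (λ _ → refl) (λ _ → refl)
                  ; sym = λ {z} {w} (p , q) → ≈ᴿ-sym {re z} {re w} p , ≈ᴿ-sym {im z} {im w} q
                  ; trans = λ {z} {w} {v} (p , q) (p′ , q′) →
                      ≈ᴿ-trans {re z} {re w} {re v} p p′ , ≈ᴿ-trans {im z} {im w} {im v} q q′
                  }
                ; ∙-cong = λ {z} {z′} {w} {w′} (p , q) (p′ , q′) →
                    +ᴿ-cong {re z} {re z′} {re w} {re w′} p p′ ,
                    +ᴿ-cong {im z} {im z′} {im w} {im w′} q q′
                }
              ; assoc = λ z w v → ≗⇒≈ {(z +ᶜ w) +ᶜ v} {z +ᶜ (w +ᶜ v)}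
                  (λ i → ℚ.+-assoc (seq (re z) i) (seq (re w) i) (seq (re v) i))
                  (λ i → ℚ.+-assoc (seq (im z) i) (seq (im w) i) (seq (im v) i))
              }
            ; identity =
                (λ z → ≗⇒≈ {0ᶜ +ᶜ z} {z} (λ _ → ℚ.+-identityˡ _) (λ _ → ℚ.+-identityˡ _)) ,
                (λ z → ≗⇒≈ {z +ᶜ 0ᶜ} {z} (λ _ → ℚ.+-identityʳ _) (λ _ → ℚ.+-identityʳ _))
            }
          ; inverse =
              (λ z → ≗⇒≈ {(-ᶜ z) +ᶜ z} {0ᶜ} (λ i → ℚ.+-inverseˡ (seq (re z) i)) (λ i → ℚ.+-inverseˡ (seq (im z) i))) ,
              (λ z → ≗⇒≈ {z +ᶜ (-ᶜ z)} {0ᶜ} (λ i → ℚ.+-inverseʳ (seq (re z) i)) (λ i → ℚ.+-inverseʳ (seq (im z) i)))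
          ; ⁻¹-cong = λ {z} {w} (p , q) → -ᴿ-cong {re z} {re w} p , -ᴿ-cong {im z} {im w} q
          }
        ; comm = λ z w → ≗⇒≈ {z +ᶜ w} {w +ᶜ z} 
            (λ i → ℚ.+-comm (seq (re z) i) (seq (re w) i))
            (λ i → ℚ.+-comm (seq (im z) i) (seq (im w) i))
        }
      ; *-cong = λ {z} {z′} {w} {w′} → *-cong {z} {z′} {w} {w′}
      ; *-assoc = *-assoc
      ; *-identity =
          (λ z → ≈-trans {1ᶜ *ᶜ z} {z *ᶜ 1ᶜ} {z} (*-comm 1ᶜ z) (*-identityʳ z)) , *-identityʳ
      ; distrib = distribˡ , λ z w v →
          ≈-trans {(w +ᶜ v) *ᶜ z} {z *ᶜ (w +ᶜ v)} {w *ᶜ z +ᶜ v *ᶜ z} (*-comm (w +ᶜ v) z)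
            (≈-trans {z *ᶜ (w +ᶜ v)} {z *ᶜ w +ᶜ z *ᶜ v} {w *ᶜ z +ᶜ v *ᶜ z} (distribˡ z w v)
              (+-cong {z *ᶜ w} {w *ᶜ z} {z *ᶜ v} {v *ᶜ z} (*-comm z w) (*-comm z v)))
      }
    ; *-comm = *-comm
    }
  }
  where
  ≈-trans : ∀ {z w v} → z ≈ w → w ≈ v → z ≈ v
  ≈-trans {z} {w} {v} (p , q) (p′ , q′) =
    ≈ᴿ-trans {re z} {re w} {re v} p p′ , ≈ᴿ-trans {im z} {im w} {im v} q q′
  +-cong : ∀ {z z′ w w′} → z ≈ z′ → w ≈ w′ → (z +ᶜ w) ≈ (z′ +ᶜ w′)
  +-cong {z} {z′} {w} {w′} (p , q) (p′ , q′) =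
    +ᴿ-cong {re z} {re z′} {re w} {re w′} p p′ , +ᴿ-cong {im z} {im z′} {im w} {im w′} q q′
  *-cong : ∀ {z z′ w w′} → z ≈ z′ → w ≈ w′ → (z *ᶜ w) ≈ (z′ *ᶜ w′)
  *-cong {z} {z′} {w} {w′} (p , q) (p′ , q′) =
    +ᴿ-cong {re z *ᴿ re w} {re z′ *ᴿ re w′} { -ᴿ (im z *ᴿ im w)} { -ᴿ (im z′ *ᴿ im w′)}
      (*ᴿ-cong {re z} {re z′} {re w} {re w′} p p′)
      (-ᴿ-cong {im z *ᴿ im w} {im z′ *ᴿ im w′} (*ᴿ-cong {im z} {im z′} {im w} {im w′} q q′)) ,
    +ᴿ-cong {re z *ᴿ im w} {re z′ *ᴿ im w′} {im z *ᴿ re w} {im z′ *ᴿ re w′}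
      (*ᴿ-cong {re z} {re z′} {im w} {im w′} p q′)
      (*ᴿ-cong {im z} {im z′} {re w} {re w′} q p′)
  *-comm : ∀ z w → (z *ᶜ w) ≈ (w *ᶜ z)
  *-comm z w = ≗⇒≈ {z *ᶜ w} {w *ᶜ z}
    (λ i → solve 4 (λ a b c d → a :* c :+ :- (b :* d) := c :* a :+ :- (d :* b)) refl
      (seq (re z) i) (seq (im z) i) (seq (re w) i) (seq (im w) i))
    (λ i → solve 4 (λ a b c d → a :* d :+ b :* c := c :* b :+ d :* a) refl
      (seq (re z) i) (seq (im z) i) (seq (re w) i) (seq (im w) i))
  *-assoc : ∀ z w v → ((z *ᶜ w) *ᶜ v) ≈ (z *ᶜ (w *ᶜ v))
  *-assoc z w v = ≗⇒≈ {(z *ᶜ w) *ᶜ v} {z *ᶜ (w *ᶜ v)}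
    (λ i → solve 6 (λ a b c d e f →
        (a :* c :+ :- (b :* d)) :* e :+ :- ((a :* d :+ b :* c) :* f) :=
        a :* (c :* e :+ :- (d :* f)) :+ :- (b :* (c :* f :+ d :* e))) refl
      (seq (re z) i) (seq (im z) i) (seq (re w) i) (seq (im w) i) (seq (re v) i) (seq (im v) i))
    (λ i → solve 6 (λ a b c d e f →
        (a :* c :+ :- (b :* d)) :* f :+ (a :* d :+ b :* c) :* e :=
        a :* (c :* f :+ d :* e) :+ b :* (c :* e :+ :- (d :* f))) refl
      (seq (re z) i) (seq (im z) i) (seq (re w) i) (seq (im w) i) (seq (re v) i) (seq (im v) i))
  *-identityʳ : ∀ z → (z *ᶜ 1ᶜ) ≈ z
  *-identityʳ z = ≗⇒≈ {z *ᶜ 1ᶜ} {z}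
    (λ i → solve 2 (λ a b → a :* con 1ℚ :+ :- (b :* con 0ℚ) := a) refl (seq (re z) i) (seq (im z) i))
    (λ i → solve 2 (λ a b → a :* con 0ℚ :+ b :* con 1ℚ := b) refl (seq (re z) i) (seq (im z) i))
  distribˡ : ∀ z w v → (z *ᶜ (w +ᶜ v)) ≈ ((z *ᶜ w) +ᶜ (z *ᶜ v))
  distribˡ z w v = ≗⇒≈ {z *ᶜ (w +ᶜ v)} {(z *ᶜ w) +ᶜ (z *ᶜ v)}
    (λ i → solve 6 (λ a b c d e f →
        a :* (c :+ e) :+ :- (b :* (d :+ f)) := (a :* c :+ :- (b :* d)) :+ (a :* e :+ :- (b :* f))) refl
      (seq (re z) i) (seq (im z) i) (seq (re w) i) (seq (im w) i) (seq (re v) i) (seq (im v) i))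
    (λ i → solve 6 (λ a b c d e f →
        a :* (d :+ f) :+ b :* (c :+ e) := (a :* d :+ b :* c) :+ (a :* f :+ b :* e)) refl
      (seq (re z) i) (seq (im z) i) (seq (re w) i) (seq (im w) i) (seq (re v) i) (seq (im v) i))

≈0ᶜ⇒Null : ∀ {z} → z ≈ 0ᶜ → Null (seq (re z)) × Null (seq (im z))
≈0ᶜ⇒Null {z} (p , q) = ≈0⇒Null {re z} p , ≈0⇒Null {im z} q

Null⇒≈0ᶜ : ∀ {z} → Null (seq (re z)) → Null (seq (im z)) → z ≈ 0ᶜ
Null⇒≈0ᶜ {z} p q = Null⇒≈0 {re z} p , Null⇒≈0 {im z} q

≈0ᶜ-stable : ∀ z → ¬ ¬ z ≈ 0ᶜ → z ≈ 0ᶜ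
≈0ᶜ-stable z ¬¬z≈0 = Null⇒≈0ᶜ {z}
  (Null-stable (re z) (λ ¬n → ¬¬z≈0 (¬n ∘ proj₁ ∘ ≈0ᶜ⇒Null {z})))
  (Null-stable (im z) (λ ¬n → ¬¬z≈0 (¬n ∘ proj₂ ∘ ≈0ᶜ⇒Null {z})))

≈0ᶜ-local : ∀ z w → (z +ᶜ w) ≈ 1ᶜ → ¬ z ≈ 0ᶜ ⊎ ¬ w ≈ 0ᶜ
≈0ᶜ-local z w (p , _) with Null-local (re z) (re w) p
... | inj₁ ¬n = inj₁ (¬n ∘ proj₁ ∘ ≈0ᶜ⇒Null {z})
... | inj₂ ¬n = inj₂ (¬n ∘ proj₁ ∘ ≈0ᶜ⇒Null {w})

-- Multiplying z w by the conjugate of z gives |z|² w, which reduces the claim to real factors.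
ℂ-domain : ∀ z w → (z *ᶜ w) ≈ 0ᶜ → ¬ z ≈ 0ᶜ → w ≈ 0ᶜ
ℂ-domain z w zw≈0 ¬z≈0 = Null⇒≈0ᶜ {w}
  (Null-cancel norm (re w) (Null-ext
    (λ i → solve 4 (λ a b c d →
      (a :* c :+ :- (b :* d)) :* a :+ (a :* d :+ b :* c) :* b := (a :* a :+ b :* b) :* c) refl
      (seq (re z) i) (seq (im z) i) (seq (re w) i) (seq (im w) i))
    (Null-+ (Null-* (re z) re-null) (Null-* (im z) im-null))) ¬norm)
  (Null-cancel norm (im w) (Null-ext
    (λ i → solve 4 (λ a b c d →
      (a :* d :+ b :* c) :* a :+ :- ((a :* c :+ :- (b :* d)) :* b) := (a :* a :+ b :* b) :* d) refl
      (seq (re z) i) (seq (im z) i) (seq (re w) i) (seq (im w) i))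
    (Null-+ (Null-* (re z) im-null) (Null-neg (Null-* (im z) re-null)))) ¬norm)
  where
  norm : ℝ
  norm = re z *ᴿ re z +ᴿ im z *ᴿ im z
  re-null = proj₁ (≈0ᶜ⇒Null {z *ᶜ w} zw≈0)
  im-null = proj₂ (≈0ᶜ⇒Null {z *ᶜ w} zw≈0)
  ¬norm : ¬ Null (seq norm)
  ¬norm n = let p , q = Null-sum-squares n in ¬z≈0 (Null⇒≈0ᶜ {z} p q)

-- Existence of primitive roots of unity

p≤p+q : ∀ p {q} → 0ℚ ℚ.≤ q → p ℚ.≤ p ℚ.+ q
p≤p+q p q≥0 = subst (ℚ._≤ p ℚ.+ _) (ℚ.+-identityʳ p) (ℚ.+-monoʳ-≤ p q≥0)

p≤q⇒0≤q-p : ∀ {p q} → p ℚ.≤ q → 0ℚ ℚ.≤ q ℚ.- p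
p≤q⇒0≤q-p {p} {q} p≤q = subst (ℚ._≤ q ℚ.- p) (ℚ.+-inverseʳ p) (ℚ.+-monoˡ-≤ (ℚ.- p) p≤q)

0≤q-p⇒p≤q : ∀ {p q} → 0ℚ ℚ.≤ q ℚ.- p → p ℚ.≤ q
0≤q-p⇒p≤q {p} {q} h = subst (p ℚ.≤_)
  (solve 2 (λ p q → p :+ (q :- p) := q) refl p q) (p≤p+q p h)

·-nonNeg : ∀ n {p} → 0ℚ ℚ.≤ p → 0ℚ ℚ.≤ n · p
·-nonNeg zero    p≥0 = ℚ.≤-refl
·-nonNeg (suc n) p≥0 = ℚ.+-mono-≤ p≥0 (·-nonNeg n p≥0)

·-mono-≤ : ∀ n {p q} → p ℚ.≤ q → n · p ℚ.≤ n · q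
·-mono-≤ zero    p≤q = ℚ.≤-refl
·-mono-≤ (suc n) p≤q = ℚ.+-mono-≤ p≤q (·-mono-≤ n p≤q)

·-comm-* : ∀ n p q → n · (p ℚ.* q) ≡ p ℚ.* (n · q)
·-comm-* zero    p q = sym (ℚ.*-zeroʳ p)
·-comm-* (suc n) p q = trans (cong (p ℚ.* q ℚ.+_) (·-comm-* n p q)) (sym (ℚ.*-distribˡ-+ p q (n · q)))

toℚᵘ-· : ∀ n p → ℚ.toℚᵘ (n · p) ℚᵘ.≃ mkℚᵘ (ℤ.+ n) 0 ℚᵘ.* ℚ.toℚᵘ p
toℚᵘ-· zero    p = ℚᵘ.≃-sym (ℚᵘ.*-zeroˡ (ℚ.toℚᵘ p))
toℚᵘ-· (suc n) p = ℚᵘ.≃-trans (ℚ.toℚᵘ-homo-+ p (n · p)) (ℚᵘ.≃-trans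
  (ℚᵘ.+-cong (ℚᵘ.≃-sym (ℚᵘ.*-identityˡ (ℚ.toℚᵘ p))) (toℚᵘ-· n p)) (ℚᵘ.≃-trans
  (ℚᵘ.≃-sym (ℚᵘ.*-distribʳ-+ (ℚ.toℚᵘ p) ℚᵘ.1ℚᵘ (mkℚᵘ (ℤ.+ n) 0)))
  (ℚᵘ.*-congʳ {ℚ.toℚᵘ p} {ℚᵘ.1ℚᵘ ℚᵘ.+ mkℚᵘ (ℤ.+ n) 0} {mkℚᵘ (ℤ.+ suc n) 0} (ℚᵘ.*≡* (cong (ℤ._* ℤ.1ℤ)
    (cong (λ i → ℤ.1ℤ ℤ.+ i) (ℤ.*-identityʳ (ℤ.+ n))))))))

i≤∣i∣ : ∀ i → i ℤ.≤ ℤ.+ ℤ.∣ i ∣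
i≤∣i∣ (ℤ.+ n)     = ℤ.≤-refl
i≤∣i∣ ℤ.-[1+ n ] = ℤ.-≤+

archimedean : ∀ p {ε} → 0ℚ ℚ.< ε → ∃[ n ] p ℚ.< suc n · ε
archimedean p@(ℚ.mkℚ a b _) {ε@(ℚ.mkℚ ℤ.+[1+ c ] d _)} ε>0 = n , ℚ.toℚᵘ-cancel-<
  (ℚᵘ.<-respʳ-≃ (ℚᵘ.≃-sym (toℚᵘ-· (suc n) ε)) (ℚᵘ.*<* (begin-strict
    a ℤ.* ℤ.+ suc (d ℕ.+ 0)                      ≡⟨ cong (λ k → a ℤ.* ℤ.+ suc k) (ℕ.+-identityʳ d) ⟩
    a ℤ.* ℤ.+ suc d                              ≤⟨ i≤∣i∣ (a ℤ.* ℤ.+ suc d) ⟩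
    ℤ.+ n                                        <⟨ ℤ.+<+ (ℕ.n<1+n n) ⟩
    ℤ.+ suc n                                    ≤⟨ ℤ.+≤+ (ℕ.≤-trans (ℕ.m≤m*n (suc n) (suc c))
                                                      (ℕ.m≤m*n (suc n ℕ.* suc c) (suc b))) ⟩
    (ℤ.+ suc n ℤ.* ℤ.+[1+ c ]) ℤ.* ℤ.+ suc b     ∎)))
  where
  open ℤ.≤-Reasoning
  -- For p = a / (b + 1) and ε = (c + 1) / (d + 1) the claim reads a (d + 1) < (n + 1) (c + 1) (b +
  -- 1), and a (d + 1) ≤ n already suffices.
  n = ℤ.∣ a ℤ.* ℤ.+ suc d ∣
archimedean p {ℚ.mkℚ (ℤ.+ 0) d _}    (ℚ.*<* (ℤ.+<+ ()))
archimedean p {ℚ.mkℚ ℤ.-[1+ c ] d _} (ℚ.*<* ())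

nested : ∀ {a b x y} → a ℚ.≤ x → x ℚ.≤ b → a ℚ.≤ y → y ℚ.≤ b → ℚ.∣ x ℚ.- y ∣ ℚ.≤ b ℚ.- a
nested {a} {b} {x} {y} a≤x x≤b a≤y y≤b with ℚ.∣p∣≡p∨∣p∣≡-p (x ℚ.- y)
... | inj₁ e = subst (ℚ._≤ _) (sym e) (ℚ.+-mono-≤ x≤b (ℚ.neg-antimono-≤ a≤y))
... | inj₂ e = subst (ℚ._≤ _) (sym (trans e (solve 2 (λ x y → :- (x :- y) := y :- x) refl x y)))
                 (ℚ.+-mono-≤ y≤b (ℚ.neg-antimono-≤ a≤x))

-- Bisection for a decidable set of rationals

module Bisection {D : Pred ℚ 0ℓ} (D? : Decidable D) where

  record Bracket : Set where
    constructor bracket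
    field
      lower upper : ℚ
      lower≤upper : lower ℚ.≤ upper
      lower∈      : D lower
      upper∉      : ¬ D upper

  open Bracket public

  width : Bracket → ℚ
  width s = upper s ℚ.- lower s

  module _ (s : Bracket) where
    mid : ℚ
    mid = ½ ℚ.* (lower s ℚ.+ upper s)

    lower≤mid : lower s ℚ.≤ mid
    lower≤mid = 0≤q-p⇒p≤q (subst (0ℚ ℚ.≤_)
      (solve 2 (λ l u → con ½ :* (u :- l) := con ½ :* (l :+ u) :- l) refl (lower s) (upper s))
      (*-nonNeg (ℚ.nonNegative⁻¹ ½) (p≤q⇒0≤q-p (lower≤upper s))))

    mid≤upper : mid ℚ.≤ upper s
    mid≤upper = 0≤q-p⇒p≤q (subst (0ℚ ℚ.≤_)
      (solve 2 (λ l u → con ½ :* (u :- l) := u :- con ½ :* (l :+ u)) refl (lower s) (upper s))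
      (*-nonNeg (ℚ.nonNegative⁻¹ ½) (p≤q⇒0≤q-p (lower≤upper s))))

  halve : Bracket → Bracket
  halve s with D? (mid s)
  ... | yes mid∈ = bracket (mid s) (upper s) (mid≤upper s) mid∈ (upper∉ s)
  ... | no  mid∉ = bracket (lower s) (mid s) (lower≤mid s) (lower∈ s) mid∉

  lower≤halve : ∀ s → lower s ℚ.≤ lower (halve s)
  lower≤halve s with D? (mid s)
  ... | yes _ = lower≤mid s
  ... | no  _ = ℚ.≤-refl

  halve≤upper : ∀ s → upper (halve s) ℚ.≤ upper s
  halve≤upper s with D? (mid s)
  ... | yes _ = ℚ.≤-refl
  ... | no  _ = mid≤upper s

  width-halve : ∀ s → width (halve s) ≡ ½ ℚ.* width s
  width-halve s with D? (mid s)
  ... | yes _ = solve 2 (λ l u → u :- con ½ :* (l :+ u) := con ½ :* (u :- l)) refl (lower s) (upper s)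
  ... | no  _ = solve 2 (λ l u → con ½ :* (l :+ u) :- l := con ½ :* (u :- l)) refl (lower s) (upper s)

  module _ (s₀ : Bracket) where

    stage : ℕ → Bracket
    stage zero    = s₀
    stage (suc n) = halve (stage n)

    lower-mono : ∀ {i j} → i ℕ.≤′ j → lower (stage i) ℚ.≤ lower (stage j)
    lower-mono ℕ.≤′-refl       = ℚ.≤-refl
    lower-mono (ℕ.≤′-step i≤j) = ℚ.≤-trans (lower-mono i≤j) (lower≤halve _)

    upper-anti : ∀ {i j} → i ℕ.≤′ j → upper (stage j) ℚ.≤ upper (stage i)
    upper-anti ℕ.≤′-refl       = ℚ.≤-refl
    upper-anti (ℕ.≤′-step i≤j) = ℚ.≤-trans (halve≤upper _) (upper-anti i≤j)

    -- The width is w₀ / 2^n, but the bound w₀ / (n + 1) is the form that `archimedean` can use. It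
    -- passes to half the width since (n + 2) w ≤ 2 (n + 1) w.
    width-bound : ∀ n → suc n · width (stage n) ℚ.≤ width s₀
    width-bound zero    = ℚ.≤-reflexive (ℚ.+-identityʳ _)
    width-bound (suc n) = subst₂ ℚ._≤_
      (trans (sym (·-comm-* (suc (suc n)) ½ (width (stage n))))
        (cong (suc (suc n) ·_) (sym (width-halve (stage n)))))
      (trans (ℚ.*-distribˡ-+ ½ (width s₀) (width s₀)) (½*+½* (width s₀)))
      (ℚ.*-monoˡ-≤-nonNeg ½ (ℚ.+-mono-≤
        (ℚ.≤-trans (p≤p+q (width (stage n)) (·-nonNeg n (p≤q⇒0≤q-p (lower≤upper (stage n))))) (width-bound n))
        (width-bound n)))

    width-small : ∀ {ε} → 0ℚ ℚ.< ε → ∃[ n ] width (stage n) ℚ.< ε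
    width-small {ε} ε>0 = let n , h = archimedean (width s₀) ε>0 in
      n , ℚ.≰⇒> λ ε≤w → ℚ.<-irrefl refl
        (ℚ.<-≤-trans h (ℚ.≤-trans (·-mono-≤ (suc n) ε≤w) (width-bound n)))

    lower-≤ : ∀ {n i} → n ≤ i → lower (stage n) ℚ.≤ lower (stage i)
    lower-≤ = lower-mono ∘ ℕ.≤⇒≤′

    upper-≤ : ∀ {n i} → n ≤ i → upper (stage i) ℚ.≤ upper (stage n)
    upper-≤ = upper-anti ∘ ℕ.≤⇒≤′

    -- Stated for two sequences: taking them equal shows each endpoint sequence to be Cauchy, and
    -- taking one of each shows that the limits agree.
    trapped : ∀ {x y : ℕ → ℚ} →
              (∀ i → lower (stage i) ℚ.≤ x i) → (∀ i → x i ℚ.≤ upper (stage i)) →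
              (∀ i → lower (stage i) ℚ.≤ y i) → (∀ i → y i ℚ.≤ upper (stage i)) →
              ∀ ε → 0ℚ ℚ.< ε → ∃[ n ] (∀ i j → n ≤ i → n ≤ j → ℚ.∣ x i ℚ.- y j ∣ ℚ.< ε)
    trapped l≤x x≤u l≤y y≤u ε ε>0 = let n , small = width-small ε>0 in n , λ i j n≤i n≤j →
      ℚ.≤-<-trans (nested
        (ℚ.≤-trans (lower-≤ n≤i) (l≤x i)) (ℚ.≤-trans (x≤u i) (upper-≤ n≤i))
        (ℚ.≤-trans (lower-≤ n≤j) (l≤y j)) (ℚ.≤-trans (y≤u j) (upper-≤ n≤j))) small

    private
      l≤l : ∀ i → lower (stage i) ℚ.≤ lower (stage i)
      l≤l i = ℚ.≤-refl
      l≤u : ∀ i → lower (stage i) ℚ.≤ upper (stage i)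
      l≤u i = lower≤upper (stage i)
      u≤u : ∀ i → upper (stage i) ℚ.≤ upper (stage i)
      u≤u i = ℚ.≤-refl

    -- Two representatives of one real number. D is never tested at the limit; instead, all terms of
    -- the first lie in D and all terms of the second outside it.
    lowerᴿ upperᴿ : ℝ
    lowerᴿ = mkℝ (lower ∘ stage) (trapped l≤l l≤u l≤l l≤u)
    upperᴿ = mkℝ (upper ∘ stage) (trapped l≤u u≤u l≤u u≤u)

    lower≈upper : lowerᴿ ≈ᴿ upperᴿ
    lower≈upper ε ε>0 = let n , h = trapped l≤l l≤u l≤u u≤u ε ε>0 in n , λ i n≤i → h i i n≤i n≤i

-- (1 + i t)ʲ = cosine j t + i sine j t, that is (1 + t²)^(j/2) cos jθ and (1 + t²)^(j/2) sin jθ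
-- for t = tan θ.
cosine sine : ℕ → ℚ → ℚ
cosine zero    t = 1ℚ
cosine (suc j) t = cosine j t ℚ.- t ℚ.* sine j t
sine zero    t = 0ℚ
sine (suc j) t = sine j t ℚ.+ t ℚ.* cosine j t

cosine-neg : ∀ j t → cosine j (ℚ.- t) ≡ cosine j t
sine-neg : ∀ j t → sine j (ℚ.- t) ≡ ℚ.- sine j t
cosine-neg zero    t = refl
cosine-neg (suc j) t = trans (cong₂ (λ c s → c ℚ.- (ℚ.- t) ℚ.* s) (cosine-neg j t) (sine-neg j t))
  (solve 3 (λ c s t → c :- (:- t) :* (:- s) := c :- t :* s) refl (cosine j t) (sine j t) t)
sine-neg zero    t = refl
sine-neg (suc j) t = trans (cong₂ (λ c s → s ℚ.+ (ℚ.- t) ℚ.* c) (cosine-neg j t) (sine-neg j t))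
  (solve 3 (λ c s t → :- s :+ (:- t) :* c := :- (s :+ t :* c)) refl (cosine j t) (sine j t) t)

-- The sum is |1 + i t|^(2j) = (1 + t²)^j, and each step multiplies it by 1 + t².
1≤cosine²+sine² : ∀ j t → 1ℚ ℚ.≤ cosine j t ℚ.* cosine j t ℚ.+ sine j t ℚ.* sine j t
1≤cosine²+sine² zero    t = ℚ.≤-refl
1≤cosine²+sine² (suc j) t = ℚ.≤-trans (1≤cosine²+sine² j t) (subst (c² ℚ.+ s² ℚ.≤_)
  (solve 3 (λ c s t → (c :* c :+ s :* s) :+ (t :* t) :* (c :* c :+ s :* s) :=
      (c :- t :* s) :* (c :- t :* s) :+ (s :+ t :* c) :* (s :+ t :* c)) refl
    (cosine j t) (sine j t) t)
  (p≤p+q (c² ℚ.+ s²) (*-nonNeg (square-nonNeg t)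
    (ℚ.+-mono-≤ (square-nonNeg (cosine j t)) (square-nonNeg (sine j t))))))
  where
  c² = cosine j t ℚ.* cosine j t
  s² = sine j t ℚ.* sine j t

-- For t = tan θ: sin jθ ≥ sin θ as soon as sin (j - 1)θ, sin jθ and sin (j + 1)θ are nonnegative.
t≤sine : ∀ j {t} → 0ℚ ℚ.< t → 0ℚ ℚ.≤ sine j t → 0ℚ ℚ.≤ sine (suc j) t →
         0ℚ ℚ.≤ sine (suc (suc j)) t → t ℚ.≤ sine (suc j) t
t≤sine j {t} t>0 s≥0 s′≥0 s″≥0 = square-cancel-≤ s′≥0 (ℚ.*-cancelˡ-≤-pos (1ℚ ℚ.+ t ℚ.* t)
  (subst ((1ℚ ℚ.+ t ℚ.* t) ℚ.* (t ℚ.* t) ℚ.≤_)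
    -- The identity sin² jθ - sin (j - 1)θ sin (j + 1)θ = sin² θ. Here it reads s′² = s s″ + t² (c²
    -- + s²), multiplied through by n = 1 + t², and c² + s² is split as 1 plus a nonnegative rest.
    (solve 3 (λ c s t →
        let s′ = s :+ t :* c ; c′ = c :- t :* s ; n = con 1ℚ :+ t :* t in
        n :* (t :* t) :+ ((n :* s) :* (s′ :+ t :* c′) :+
          (t :* t) :* (n :* ((c :* c :+ s :* s) :- con 1ℚ))) := n :* (s′ :* s′)) refl
      (cosine j t) (sine j t) t)
    (p≤p+q _ (ℚ.+-mono-≤ (*-nonNeg (*-nonNeg n≥0 s≥0) s″≥0)
      (*-nonNeg (square-nonNeg t) (*-nonNeg n≥0 (p≤q⇒0≤q-p (1≤cosine²+sine² j t))))))))
  where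
  n≥0 : 0ℚ ℚ.≤ 1ℚ ℚ.+ t ℚ.* t
  n≥0 = ℚ.+-mono-≤ (ℚ.nonNegative⁻¹ 1ℚ) (square-nonNeg t)
  instance
    n-pos = ℚ.positive (ℚ.+-mono-<-≤ (ℚ.positive⁻¹ 1ℚ) (square-nonNeg t))

record SmallAngle (j : ℕ) (t : ℚ) : Set where
  field
    0≤sine    : 0ℚ ℚ.≤ sine j t
    sine≤jt   : sine j t ℚ.≤ j · t
    1-jt≤cos  : 1ℚ ℚ.- j · t ℚ.≤ cosine j t
    cos≤1     : cosine j t ℚ.≤ 1ℚ

-- The goal is `0≤sine`; the other bounds carry the induction. The lower bound on the cosine and j t
-- ≤ 1 keep the sine growing, while the two sine bounds control the decrease of the cosine.
smallAngle : ∀ j {t} → 0ℚ ℚ.≤ t → j · t ℚ.≤ 1ℚ → SmallAngle j t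
smallAngle zero t≥0 _ = record
  { 0≤sine = ℚ.≤-refl ; sine≤jt = ℚ.≤-refl ; 1-jt≤cos = ℚ.≤-refl ; cos≤1 = ℚ.≤-refl }
smallAngle (suc j) {t} t≥0 jt+t≤1 = record
  { 0≤sine   = ℚ.+-mono-≤ 0≤sine (*-nonNeg t≥0 (ℚ.≤-trans (p≤q⇒0≤q-p jt≤1) 1-jt≤cos))
  ; sine≤jt  = subst (sine j t ℚ.+ t ℚ.* cosine j t ℚ.≤_) (ℚ.+-comm (j · t) t)
      (ℚ.+-mono-≤ sine≤jt (t*≤t cos≤1))
  ; 1-jt≤cos = subst (ℚ._≤ cosine j t ℚ.- t ℚ.* sine j t)
      (solve 2 (λ x t → (con 1ℚ :- x) :- t := con 1ℚ :- (t :+ x)) refl (j · t) t)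
      (ℚ.+-mono-≤ 1-jt≤cos (ℚ.neg-antimono-≤ (t*≤t (ℚ.≤-trans sine≤jt jt≤1))))
  ; cos≤1    = ℚ.≤-trans (0≤q-p⇒p≤q (subst (0ℚ ℚ.≤_)
      (solve 2 (λ c x → x := c :- (c :- x)) refl (cosine j t) (t ℚ.* sine j t))
      (*-nonNeg t≥0 0≤sine))) cos≤1
  }
  where
  jt≤1 : j · t ℚ.≤ 1ℚ
  jt≤1 = ℚ.≤-trans (subst (ℚ._≤ t ℚ.+ j · t) (ℚ.+-identityˡ (j · t)) (ℚ.+-monoˡ-≤ (j · t) t≥0)) jt+t≤1
  open SmallAngle (smallAngle j t≥0 jt≤1)
  t*≤t : ∀ {x} → x ℚ.≤ 1ℚ → t ℚ.* x ℚ.≤ t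
  t*≤t {x} x≤1 = subst (t ℚ.* x ℚ.≤_) (ℚ.*-identityʳ t) (ℚ.*-monoˡ-≤-nonNeg t {{ℚ.nonNegative t≥0}} x≤1)

-- The witness is 2^(-n): halving t turns t ≤ 1 and n t ≤ 1 into t/2 + n t/2 ≤ ½ + ½.
smallTangent : ∀ n → ∃[ t ] (0ℚ ℚ.< t × t ℚ.≤ 1ℚ × n · t ℚ.≤ 1ℚ)
smallTangent zero    = 1ℚ , ℚ.positive⁻¹ 1ℚ , ℚ.≤-refl , ℚ.nonNegative⁻¹ 1ℚ
smallTangent (suc n) with smallTangent n
... | t , t>0 , t≤1 , nt≤1 = ½ ℚ.* t , ½*-pos t>0 ,
  ℚ.≤-trans (half t≤1) (ℚ.*≤* (ℤ.+≤+ (s≤s z≤n))) ,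
  ℚ.≤-trans (ℚ.+-mono-≤ (half t≤1) (ℚ.≤-trans (ℚ.≤-reflexive (·-comm-* n ½ t)) (half nt≤1)))
    ℚ.≤-refl
  where
  half : ∀ {p} → p ℚ.≤ 1ℚ → ½ ℚ.* p ℚ.≤ ½ ℚ.* 1ℚ
  half = ℚ.*-monoˡ-≤-nonNeg ½

-- Reciprocals of reals whose terms are at least 1

1≤⇒nonZero : ∀ {p} → 1ℚ ℚ.≤ p → ℚ.NonZero p
1≤⇒nonZero {p} 1≤p = ℚ.pos⇒nonZero p {{ℚ.positive (ℚ.<-≤-trans (ℚ.positive⁻¹ 1ℚ) 1≤p)}}

recip : ∀ p → 1ℚ ℚ.≤ p → ℚ
recip p 1≤p = ℚ.1/_ p {{1≤⇒nonZero 1≤p}}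

*-recip : ∀ p 1≤p → p ℚ.* recip p 1≤p ≡ 1ℚ
*-recip p 1≤p = ℚ.*-inverseʳ p {{1≤⇒nonZero 1≤p}}

recip-nonNeg : ∀ p 1≤p → 0ℚ ℚ.≤ recip p 1≤p
recip-nonNeg p 1≤p = ℚ.<⇒≤ (ℚ.positive⁻¹ _ {{ℚ.1/pos⇒pos p {{ℚ.positive (ℚ.<-≤-trans (ℚ.positive⁻¹ 1ℚ) 1≤p)}}}})

recip≤1 : ∀ p 1≤p → recip p 1≤p ℚ.≤ 1ℚ
recip≤1 p 1≤p = subst₂ ℚ._≤_ (ℚ.*-identityˡ _) (*-recip p 1≤p)
  (ℚ.*-monoʳ-≤-nonNeg (recip p 1≤p) {{ℚ.nonNegative (recip-nonNeg p 1≤p)}} 1≤p)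

-- 1/p - 1/q = (q - p) / (p q), and both reciprocals are at most 1. Being 1-Lipschitz, the
-- reciprocal keeps the Cauchy modulus.
recip-diff : ∀ p q 1≤p 1≤q → ℚ.∣ recip p 1≤p ℚ.- recip q 1≤q ∣ ℚ.≤ ℚ.∣ q ℚ.- p ∣
recip-diff p q 1≤p 1≤q = begin
  ℚ.∣ f ℚ.- g ∣                          ≡⟨ cong₂ (λ x y → ℚ.∣ x ℚ.- y ∣)
                                              (by-1 f g q (*-recip q 1≤q)) (by-1 g f p (*-recip p 1≤p)) ⟩
  ℚ.∣ f ℚ.* (q ℚ.* g) ℚ.- g ℚ.* (p ℚ.* f) ∣
    ≡⟨ cong ℚ.∣_∣ (solve 4 (λ f g p q → f :* (q :* g) :- g :* (p :* f) := (f :* g) :* (q :- p)) refl f g p q) ⟩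
  ℚ.∣ (f ℚ.* g) ℚ.* (q ℚ.- p) ∣          ≡⟨ ℚ.∣p*q∣≡∣p∣*∣q∣ (f ℚ.* g) (q ℚ.- p) ⟩
  ℚ.∣ f ℚ.* g ∣ ℚ.* ℚ.∣ q ℚ.- p ∣        ≡⟨ cong (ℚ._* ℚ.∣ q ℚ.- p ∣) (ℚ.0≤p⇒∣p∣≡p (*-nonNeg f≥0 g≥0)) ⟩
  f ℚ.* g ℚ.* ℚ.∣ q ℚ.- p ∣              ≤⟨ ℚ.*-monoʳ-≤-nonNeg ℚ.∣ q ℚ.- p ∣ {{ℚ.∣-∣-nonNeg (q ℚ.- p)}}
                                              (*-mono-≤ g≥0 (ℚ.nonNegative⁻¹ 1ℚ) (recip≤1 p 1≤p) (recip≤1 q 1≤q)) ⟩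
  1ℚ ℚ.* ℚ.∣ q ℚ.- p ∣                   ≡⟨ ℚ.*-identityˡ _ ⟩
  ℚ.∣ q ℚ.- p ∣                          ∎
  where
  open ℚ.≤-Reasoning
  f = recip p 1≤p
  g = recip q 1≤q
  f≥0 = recip-nonNeg p 1≤p
  g≥0 = recip-nonNeg q 1≤q
  by-1 : ∀ x y r → r ℚ.* y ≡ 1ℚ → x ≡ x ℚ.* (r ℚ.* y)
  by-1 x y r e = sym (trans (cong (x ℚ.*_) e) (ℚ.*-identityʳ x))

recipᴿ : ∀ x → (∀ i → 1ℚ ℚ.≤ seq x i) → ℝ
recipᴿ x 1≤x = mkℝ (λ i → recip (seq x i) (1≤x i)) λ ε ε>0 →
  let N , near = isCauchy x ε ε>0 in
  N , λ i j N≤i N≤j → ℚ.≤-<-trans (recip-diff _ _ (1≤x i) (1≤x j)) (near j i N≤j N≤i)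

ℂ-field : ConstructiveField
ℂ-field = record
  { commutativeRing = ℂ-commutativeRing
  ; rationals = record
    { ⟦_⟧    = λ q → ℚ→ℝ q +i ℚ→ℝ 0ℚ
    ; +-homo = λ p q → ≗⇒≈ {ℚ→ℝ (p ℚ.+ q) +i ℚ→ℝ 0ℚ} {(ℚ→ℝ p +i ℚ→ℝ 0ℚ) +ᶜ (ℚ→ℝ q +i ℚ→ℝ 0ℚ)}
        (λ _ → refl) (λ _ → refl)
    ; *-homo = λ p q → ≗⇒≈ {ℚ→ℝ (p ℚ.* q) +i ℚ→ℝ 0ℚ} {(ℚ→ℝ p +i ℚ→ℝ 0ℚ) *ᶜ (ℚ→ℝ q +i ℚ→ℝ 0ℚ)}
        (λ _ → solve 2 (λ p q → p :* q := p :* q :+ :- (con 0ℚ :* con 0ℚ)) refl p q)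
        (λ _ → solve 2 (λ p q → con 0ℚ := p :* con 0ℚ :+ con 0ℚ :* q) refl p q)
    ; -‿homo = λ p → ≗⇒≈ {ℚ→ℝ (ℚ.- p) +i ℚ→ℝ 0ℚ} { -ᶜ (ℚ→ℝ p +i ℚ→ℝ 0ℚ)} (λ _ → refl) (λ _ → refl)
    ; 0-homo = ≗⇒≈ {0ᶜ} {0ᶜ} (λ _ → refl) (λ _ → refl)
    ; 1-homo = ≗⇒≈ {1ᶜ} {1ᶜ} (λ _ → refl) (λ _ → refl)
    }
  ; stable = ≈0ᶜ-stable
  ; domain = ℂ-domain
  ; local  = ≈0ᶜ-local
  }

line : ℝ → ℂ
line x = ℚ→ℝ 1ℚ +i x

seq-line^ : ∀ x j i → seq (re (line x ^ j)) i ≡ cosine j (seq x i) ×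
                      seq (im (line x ^ j)) i ≡ sine j (seq x i)
seq-line^ x zero    i = refl , refl
seq-line^ x (suc j) i with seq-line^ x j i
... | p , q =
  cong₂ ℚ._+_ (trans (ℚ.*-identityˡ _) p) (cong (λ s → ℚ.- (seq x i ℚ.* s)) q) ,
  cong₂ ℚ._+_ (trans (ℚ.*-identityˡ _) q) (cong (seq x i ℚ.*_) p)

Eventually-∀ : ∀ n {P : Fin n → ℕ → Set} → (∀ j → Eventually (P j)) → Eventually (λ i → ∀ j → P j i)
Eventually-∀ zero    h = 0 , λ _ _ ()
Eventually-∀ (suc n) h = Eventually-∧ (λ { p q zero → p ; p q (suc j) → q j })
  (h zero) (Eventually-∀ n (h ∘ suc))

·-monoˡ-≤ : ∀ {m n p} → 0ℚ ℚ.≤ p → m ≤ n → m · p ℚ.≤ n · p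
·-monoˡ-≤ {n = n} p≥0 z≤n = ·-nonNeg n p≥0
·-monoˡ-≤ {p = p} p≥0 (s≤s m≤n) = ℚ.+-monoʳ-≤ p (·-monoˡ-≤ p≥0 m≤n)

module Boundary (N : ℕ) (3≤N : 3 ≤ N) where

  -- For t = tan θ with 0 < θ < π/2 this means θ ≤ π/N: beyond π/N, the first multiple jθ exceeding
  -- π is below 2π and has j ≤ N. Hence the boundary point is tan (π/N).
  SinesNonNeg : Pred ℚ 0ℓ
  SinesNonNeg t = (j : Fin (suc N)) → 0ℚ ℚ.≤ sine (toℕ j) t

  SinesNonNeg? : Decidable SinesNonNeg
  SinesNonNeg? t = Fin.all? (λ j → 0ℚ ℚ.≤? sine (toℕ j) t)

  open Bisection SinesNonNeg?

  t₀ : ℚ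
  t₀ = proj₁ (smallTangent N)

  t₀>0 : 0ℚ ℚ.< t₀
  t₀>0 = proj₁ (proj₂ (smallTangent N))

  start : Bracket
  start = bracket t₀ (1ℚ ℚ.+ 1ℚ)
    (ℚ.≤-trans (proj₁ (proj₂ (proj₂ (smallTangent N)))) (p≤p+q 1ℚ (ℚ.nonNegative⁻¹ 1ℚ)))
    (λ j → SmallAngle.0≤sine (smallAngle (toℕ j) (ℚ.<⇒≤ t₀>0) (ℚ.≤-trans
      (·-monoˡ-≤ (ℚ.<⇒≤ t₀>0) (ℕ.s≤s⁻¹ (Fin.toℕ<n j)))
      (proj₂ (proj₂ (proj₂ (smallTangent N)))))))
    -- `sine 3 t` is 3 t - t³, which is -2 at t = 2; the bound 3 ≤ N brings this index into range.
    (λ nonNeg → from-no (0ℚ ℚ.≤? sine 3 (1ℚ ℚ.+ 1ℚ)) 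
      (subst (λ k → 0ℚ ℚ.≤ sine k (1ℚ ℚ.+ 1ℚ)) (Fin.toℕ-fromℕ< (s≤s 3≤N)) (nonNeg (fromℕ< (s≤s 3≤N)))))

  c c′ : ℝ
  c  = lowerᴿ start
  c′ = upperᴿ start

  t₀≤c : ∀ i → t₀ ℚ.≤ seq c i
  t₀≤c i = lower-≤ start {0} {i} z≤n

  t₀≤sine : ∀ j i → 0 ℕ.< j → j ℕ.< N → t₀ ℚ.≤ sine j (seq c i)
  t₀≤sine (suc j) i _ j+1<N = ℚ.≤-trans (t₀≤c i) (t≤sine j (ℚ.<-≤-trans t₀>0 (t₀≤c i))
    (nonNeg j (ℕ.<-trans (ℕ.n<1+n j) (ℕ.m<n⇒m<1+n j+1<N)))
    (nonNeg (suc j) (ℕ.m<n⇒m<1+n j+1<N)) (nonNeg (suc (suc j)) (s≤s j+1<N)))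
    where
    nonNeg : ∀ k → k ℕ.< suc N → 0ℚ ℚ.≤ sine k (seq c i)
    nonNeg k k≤N = subst (λ k → 0ℚ ℚ.≤ sine k (seq c i)) (Fin.toℕ-fromℕ< k≤N)
      (lower∈ (stage start i) (fromℕ< k≤N))

  -- Instead of a continuity estimate: c and c′ are equal reals, so congruence of powers equates (1
  -- + i c)^j and (1 + i c′)^j.
  sine-near : ∀ j → Null (λ i → sine j (seq c i) ℚ.- sine j (seq c′ i))
  sine-near j = Null-ext
    (λ i → cong₂ ℚ._-_ (proj₂ (seq-line^ c j i)) (proj₂ (seq-line^ c′ j i)))
    (proj₂ (FieldProperties.^-congˡ ℂ-field j {line c} {line c′}
      (≗⇒≈ᴿ {ℚ→ℝ 1ℚ} {ℚ→ℝ 1ℚ} (λ _ → refl) , lower≈upper start)))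

  -- At an upper endpoint some sine is negative; by t₀≤sine it can only be the N-th one.
  sine-N-null : Null (λ i → sine N (seq c i))
  sine-N-null ε ε>0 = Eventually-map
    (λ {i} (near , nearN) → let j , sine<0 = Fin.¬∀⟶∃¬ (suc N) _ (λ j → 0ℚ ℚ.≤? sine (toℕ j) (seq c′ i))
                                           (upper∉ (stage start i))
                  in conclude i (toℕ j) (ℕ.s≤s⁻¹ (Fin.toℕ<n j)) (near j) nearN (lower∈ (stage start i) j)
                       (ℚ.≰⇒> sine<0) (toℕ j ℕ.≟ 0) (toℕ j ℕ.≟ N))
    -- The index of the negative sine varies with i, so all sines are made close at once. The
    -- tolerance `t₀` is the lower bound from `t₀≤sine`, which rules out 0 < j < N.
    (Eventually-∧ _,_ (Eventually-∀ (suc N) (λ j → sine-near (toℕ j) t₀ t₀>0)) (sine-near N ε ε>0))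
    where
    below : ∀ {p q δ} → ℚ.∣ p ℚ.- q ∣ ℚ.< δ → q ℚ.< 0ℚ → p ℚ.< δ
    below {p} {q} {δ} near q<0 = begin-strict
      p                        ≡⟨ solve 2 (λ p q → p := (p :- q) :+ q) refl p q ⟩
      (p ℚ.- q) ℚ.+ q          <⟨ ℚ.+-monoʳ-< (p ℚ.- q) q<0 ⟩
      (p ℚ.- q) ℚ.+ 0ℚ         ≡⟨ ℚ.+-identityʳ _ ⟩
      p ℚ.- q                  ≤⟨ p≤∣p∣ (p ℚ.- q) ⟩
      ℚ.∣ p ℚ.- q ∣            <⟨ near ⟩
      δ                        ∎
      where open ℚ.≤-Reasoning
    conclude : ∀ i k → k ≤ N → ℚ.∣ sine k (seq c i) ℚ.- sine k (seq c′ i) ∣ ℚ.< t₀ →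
               ℚ.∣ sine N (seq c i) ℚ.- sine N (seq c′ i) ∣ ℚ.< ε →
               0ℚ ℚ.≤ sine k (seq c i) → sine k (seq c′ i) ℚ.< 0ℚ →
               Dec (k ≡ 0) → Dec (k ≡ N) → ℚ.∣ sine N (seq c i) ∣ ℚ.< ε
    conclude i .0 _ _ _ _ sine<0 (yes refl) _ = contradiction sine<0 (ℚ.<-irrefl refl)
    conclude i .N _ _ near sine≥0 sine<0 (no _) (yes refl) =
      subst (ℚ._< ε) (sym (ℚ.0≤p⇒∣p∣≡p sine≥0)) (below near sine<0)
    conclude i k k≤N near _ _ sine<0 (no k≢0) (no k≢N) = contradiction
      (ℚ.<-≤-trans (below near sine<0) (t₀≤sine k i (ℕ.n≢0⇒n>0 k≢0) (ℕ.≤∧≢⇒< k≤N k≢N)))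
      (ℚ.<-irrefl refl)

-- With t = tan θ the real number c, sin Nθ = 0 while sin jθ is bounded away from 0 for 0 < j < N,
-- so that ζ = (1 + i c)² / (1 + c²) = e^{2iθ} is a primitive N-th root of unity.
module PrimitiveRoot (N : ℕ) (c : ℝ) (t₀ : ℚ) (t₀>0 : 0ℚ ℚ.< t₀)
  (t₀≤sine : ∀ j i → 0 ℕ.< j → j ℕ.< N → t₀ ℚ.≤ sine j (seq c i))
  (sine-N-null : Null (λ i → sine N (seq c i))) where

  open FieldProperties ℂ-field using (Primitive; square-quotient-root⇒; square-quotient-root⇐)

  1+c² : ℝ
  1+c² = ℚ→ℝ 1ℚ +ᴿ c *ᴿ c

  1≤1+c² : ∀ i → 1ℚ ℚ.≤ seq 1+c² i
  1≤1+c² i = p≤p+q 1ℚ (square-nonNeg (seq c i))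

  r : ℂ
  r = recipᴿ 1+c² 1≤1+c² +i ℚ→ℝ 0ℚ

  ζ : ℂ
  ζ = line c *ᶜ line c *ᶜ r

  norm-inverse : (line c *ᶜ line (-ᴿ c) *ᶜ r) ≈ 1ᶜ
  norm-inverse = ≗⇒≈ {line c *ᶜ line (-ᴿ c) *ᶜ r} {1ᶜ}
    (λ i → trans
      (solve 2 (λ t f → (con 1ℚ :* con 1ℚ :+ :- (t :* :- t)) :* f :+ :- ((con 1ℚ :* :- t :+ t :* con 1ℚ) :* con 0ℚ)
        := (con 1ℚ :+ t :* t) :* f) refl (seq c i) (seq (re r) i))
      (*-recip (seq 1+c² i) (1≤1+c² i)))
    (λ i → solve 2 (λ t f → (con 1ℚ :* con 1ℚ :+ :- (t :* :- t)) :* con 0ℚ :+ (con 1ℚ :* :- t :+ t :* con 1ℚ) :* f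
        := con 0ℚ) refl (seq c i) (seq (re r) i))

  conjugate-re : ∀ j i → seq (re (line c ^ j)) i ≡ seq (re (line (-ᴿ c) ^ j)) i
  conjugate-re j i = trans (proj₁ (seq-line^ c j i)) (trans (sym (cosine-neg j (seq c i)))
    (sym (proj₁ (seq-line^ (-ᴿ c) j i))))

  conjugate-im : ∀ j i → seq (im (line c ^ j)) i ℚ.- seq (im (line (-ᴿ c) ^ j)) i ≡
                         sine j (seq c i) ℚ.+ sine j (seq c i)
  conjugate-im j i = trans
    (cong₂ ℚ._-_ (proj₂ (seq-line^ c j i)) (trans (proj₂ (seq-line^ (-ᴿ c) j i)) (sine-neg j (seq c i))))
    (solve 1 (λ s → s :- :- s := s :+ s) refl (sine j (seq c i)))

  ζ-primitive : Primitive N ζ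
  ζ-primitive =
    square-quotient-root⇐ (line c) (line (-ᴿ c)) r norm-inverse N
      (≗⇒≈ᴿ {re (line c ^ N)} {re (line (-ᴿ c) ^ N)} (conjugate-re N) ,
       Null-ext (λ i → sym (conjugate-im N i)) (Null-+ sine-N-null sine-N-null)) ,
    λ j 0<j j<N ζʲ≈1 → BoundedAway⇒¬Null
      (t₀ , t₀>0 , 0 , λ i _ → ℚ.≤-trans (ℚ.≤-trans (t₀≤sine j i 0<j j<N)
        (p≤p+q _ (ℚ.≤-trans (ℚ.<⇒≤ t₀>0) (t₀≤sine j i 0<j j<N)))) (p≤∣p∣ _))
      (Null-ext (conjugate-im j)
        (proj₂ (square-quotient-root⇒ (line c) (line (-ᴿ c)) r norm-inverse j ζʲ≈1)))

primitive-root-3≤ : ∀ N → 3 ≤ N → ∃[ ζ ] FieldProperties.Primitive ℂ-field N ζ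
primitive-root-3≤ N 3≤N = ζ , ζ-primitive
  where
  open Boundary N 3≤N using (c; t₀; t₀>0; t₀≤sine; sine-N-null)
  open PrimitiveRoot N c t₀ t₀>0 t₀≤sine sine-N-null

-- Passing to 3 m meets the bound 3 ≤ N, and the cube of a primitive root of order 3 m has order m.
-- The exponent `1 ℕ.* 3` is the product l d of `Primitive-power` with l = 1 and d = 3.
primitive-root : ∀ m .{{_ : NonZero m}} → ∃[ ω ] FieldProperties.Primitive ℂ-field m ω
primitive-root m =
  let ζ , ζ-primitive = primitive-root-3≤ (m ℕ.* 3) (ℕ.m≤n*m 3 m)
  in ζ ^ (1 ℕ.* 3) , FieldProperties.Primitive-power ℂ-field m 1 3 (∣1⇒≡1 ∘ proj₂) ζ-primitive

-- Heights and the theorem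

open FieldProperties ℂ-field using (sum-^1≈0⇒; sum-^1≈0⇐)
open Multiplicities ℂ-field

HasVanishing⇒Solution : ∀ {n k h} → HasVanishing n 1 k h → Solution n k h
HasVanishing⇒Solution (y , (root , vanish) , mult) = y , root , sum-^1≈0⇒ y vanish , mult

Solution⇒HasVanishing : ∀ {n k h} → Solution n k h → HasVanishing n 1 k h
Solution⇒HasVanishing (y , root , vanish , mult) = y , (root , sum-^1≈0⇐ y vanish) , mult

module Comparison (n k l d : ℕ) {{k≢0 : NonZero k}} {{d≢0 : NonZero d}}
  (k⊥l : Coprime k l) (0<n : 0 ℕ.< n) where

  to-bounded : DistinctSolution n (k ℕ.* d) (l ℕ.* d) → Solution n k d
  to-bounded = distinct⇒bounded n k l d {{d≢0}} k⊥l

  to-distinct : Solution n k d → DistinctSolution n (k ℕ.* d) (l ℕ.* d)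
  to-distinct = bounded⇒distinct n k l d {{k≢0}} {{d≢0}} k⊥l
    (primitive-root (k ℕ.* d) {{ℕ.m*n≢0 k d {{k≢0}} {{d≢0}}}})

  to-W : ∀ {h} → Solution n k h → n ∈ W 1 k
  to-W {h} sol =
    let y , vanishing , _ = Solution⇒HasVanishing {n} {k} {h} sol in 0<n , y , vanishing

  -- The conclusion asks for the exact height, not just for a solution with multiplicities at most
  -- d, so the least admissible bound is searched for below d.
  height⇒ : (H[ n ⨾ l ℕ.* d , k ℕ.* d ]≡ 1) → (H[ n ⨾ 1 , k ]≤ d)
  height⇒ H =
    let x , (root , vanish) , mult = H[_⨾_,_]≡_.attained H
        h , 0<h , h≤d , sol , minimal = least-bound n k d {{k≢0}} {{d≢0}} (primitive-root k {{k≢0}})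
          (to-bounded (x , root , vanish , Multiplicity≤1⇒Distinct x mult))
    in h , record
         { defined  = to-W {h} sol
         ; positive = 0<h
         ; attained = Solution⇒HasVanishing {n} {k} {h} sol
         ; minimal  = λ h′ 0<h′ sol′ → minimal h′ 0<h′ (HasVanishing⇒Solution {n} {k} {h′} sol′)
         } , h≤d

  height⇐ : (H[ n ⨾ 1 , k ]≤ d) → (H[ n ⨾ l ℕ.* d , k ℕ.* d ]≡ 1)
  height⇐ (h , H , h≤d) =
    let y , root , vanish , mult = HasVanishing⇒Solution {n} {k} {h} (H[_⨾_,_]≡_.attained H)
        x , root′ , vanish′ , distinct =
          to-distinct (y , root , vanish , Multiplicity≤-mono y h≤d mult)
    in record
         { defined  = 0<n , x , root′ , vanish′
         ; positive = s≤s z≤n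
         ; attained = x , (root′ , vanish′) , Distinct⇒Multiplicity≤1 x distinct
         ; minimal  = λ _ 0<h′ _ → 0<h′
         }

  comparison : ((H[ n ⨾ l ℕ.* d , k ℕ.* d ]≡ 1) ⇔ (H[ n ⨾ 1 , k ]≤ d)) ×
               (DistinctSolution n (k ℕ.* d) (l ℕ.* d) ⇔ (n ∈ W 1 k × Solution n k d))
  comparison = mk⇔ height⇒ height⇐ ,
    mk⇔ (λ sol → to-W {d} (to-bounded sol) , to-bounded sol) (to-distinct ∘ proj₂)

theorem3 : ∀ (m ℓ n : ℕ) .{{_ : NonZero m}} .{{_ : NonZero ℓ}} → 2 ≤ n → n ≤ m →
    let d = gcd m ℓ in
    ((H[ n ⨾ ℓ , m ]≡ 1) ⇔ (H[ n ⨾ 1 , m / d ]≤ d))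
    ×
    ((∃[ x ] ((∀ i → x i ∈ Ω m) × (sum {n} (λ i → x i ^ ℓ) ≈ 0ᶜ) × PairwiseDistinct x))
    ⇔
    ((n ∈ W 1 (m / d)) ×
    (∃[ y ] ((∀ i → y i ∈ Ω (m / d)) × (sum {n} y ≈ 0ᶜ) × MultiplicityAtMost d y))))
theorem3 m ℓ n 2≤n n≤m = subst₂
  (λ m′ ℓ′ → ((H[ n ⨾ ℓ′ , m′ ]≡ 1) ⇔ (H[ n ⨾ 1 , k ]≤ d)) ×
             (DistinctSolution n m′ ℓ′ ⇔ (n ∈ W 1 k × Solution n k d)))
  (m/n*n≡m (gcd[m,n]∣m m ℓ)) (m/n*n≡m (gcd[m,n]∣n m ℓ))
  (Comparison.comparison n k (ℓ / d) d {{k≢0}} {{gcd-nonZero}}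
    (coprime-/gcd m ℓ) (ℕ.<-≤-trans (s≤s z≤n) 2≤n))
  where
  d = gcd m ℓ
  k = m / d
  k≢0 : NonZero k
  k≢0 = ℕ.>-nonZero (m≥n⇒m/n>0 (∣⇒≤ (gcd[m,n]∣m m ℓ)))
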